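{- Let $T=(\mathcal L,\mathcal R)$ be a GT system and $\mathbf D\subseteq\mathcal G(\mathcal L)$. If all non-garbage critical pairs of $T$ with respect to $\mathbf D$ are strongly joinable, then $T$ is locally confluent on $\mathbf D$.
   Context: Fix a label alphabet $\mathcal L=(\mathcal L_V,\mathcal L_E)$ of finite sets. Graphs are totally labelled: $G=(V,E,s,t,l,m)$ with $V,E$ finite, $s,t:E\to V$, $l:V\to\mathcal L_V$, $m:E\to\mathcal L_E$ total; morphisms preserve sources, targets and labels; $\mathcal G(\mathcal L)$ is the set of isomorphism classes. $H$ is a subgraph of $G$ if there is an inclusion morphism $H\hookrightarrow G$. A rule $\langle L\leftarrow K\rightarrow R\rangle$ consists of such graphs with $K$ a subgraph of $L$ and $R$. A direct derivation $G\Rightarrow_{r,g}H$ uses an injective match $g:L\to G$ satisfying the dangling condition (no edge outside $g(L)$ incident to a node in $g(V_L\setminus V_K)$); it deletes $g(L\setminus K)$ giving $D\subseteq G$, then adds $R\setminus K$ disjointly giving $H\supseteq D$, with comatch $h:R\to H$. A GT system $T=(\mathcal L,\mathcal R)$ has a finite rule set. The track morphism of $G\Rightarrow H$ is the partial map $G\rightharpoonup H$ which is the identity (via $D$) on items of $D$ and undefined elsewhere; tracks of derivation sequences are composites. Steps $H_1\Leftarrow_{r_1,g_1}G\Rightarrow_{r_2,g_2}H_2$ are parallelly independent if $g_1(L_1)\cap g_2(L_2)\subseteq g_1(K_1)\cap g_2(K_2)$. Such a pair is a critical pair if $G=g_1(L_1)\cup g_2(L_2)$, the steps are not parallelly independent,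 and $g_1\ne g_2$ when $r_1=r_2$. Its persistent nodes are the nodes $v$ of $G$ for which both tracks $G\Rightarrow H_1$ and $G\Rightarrow H_2$ are defined. It is strongly joinable if there are a graph $M$ and derivations $H_1\Rightarrow^*M\Leftarrow^*H_2$ such that for every persistent node $v$, the tracks of $G\Rightarrow H_1\Rightarrow^*M$ and $G\Rightarrow H_2\Rightarrow^*M$ are both defined at $v$ and equal. A set $\mathbf D\subseteq\mathcal G(\mathcal L)$ is subgraph closed if $[G]\in\mathbf D$ and $H$ a subgraph of $G$ imply $[H]\in\mathbf D$; the subgraph closure $\overline{\mathbf D}$ is the smallest subgraph-closed set containing $\mathbf D$. A critical pair $H_1\Leftarrow G\Rightarrow H_2$ is non-garbage w.r.t. $\mathbf D$ if $[G]\in\overline{\mathbf D}$. Graphs $H_1,H_2$ are joinable if $H_1\Rightarrow^*M\Leftarrow^*H_2$ for some $M$. $T$ is locally confluent on $\mathbf D$ if for all $G$ with $[G]\in\mathbf D$, $H_1\Leftarrow G\Rightarrow H_2$ implies $H_1,H_2$ joinable. -}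

module Defs where

open import Data.Fin.Base using (Fin)
open import Data.Nat.Base using (ℕ)
open import Data.Product.Base using (∃; ∃-syntax; Σ-syntax; _×_)
open import Data.Sum.Base using (_⊎_)
open import Function.Base using (_∘_)
open import Function.Bundles using (_↔_; _⇔_)
open import Function.Definitions using (Injective; Surjective)
open import Level using (Level; _⊔_) renaming (suc to lsuc; zero to lzero)
open import Relation.Binary.PropositionalEquality.Core using (_≡_; subst)
open import Relation.Nullary.Negation.Core using (¬_)
open import Relation.Unary using (Pred)
open import Relation.Binary.Definitions using (_Respects_)

record FiniteSet : Set₁ where
  field
    Carrier     : Set
    size        : ℕ
    enumeration : Carrier ↔ Fin size

open FiniteSet using (Carrier)

record Alphabet : Set₁ where
  field
    nodeLabels : FiniteSet
    edgeLabels : FiniteSet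

open Alphabet

record Graph (ℒ : Alphabet) : Set₁ where
  field
    nodes  : FiniteSet
    edges  : FiniteSet

  Node : Set
  Node = Carrier nodes

  Edge : Set
  Edge = Carrier edges

  field
    source target : Edge → Node
    nodeLabel     : Node → Carrier (nodeLabels ℒ)
    edgeLabel     : Edge → Carrier (edgeLabels ℒ)

open Graph

record Morphism {ℒ : Alphabet} (G H : Graph ℒ) : Set where
  field
    onNodes     : Node G → Node H
    onEdges     : Edge G → Edge H
    source-≡    : ∀ e → source H (onEdges e) ≡ onNodes (source G e)
    target-≡    : ∀ e → target H (onEdges e) ≡ onNodes (target G e)
    nodeLabel-≡ : ∀ v → nodeLabel H (onNodes v) ≡ nodeLabel G v
    edgeLabel-≡ : ∀ e → edgeLabel H (onEdges e) ≡ edgeLabel G e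

infix 4 _↪_ _≅_ _≗_ _∈Im_ _∈Im_∖_
infixr 5 _◅_

-- Types carry no literal inclusions, so "G is a subgraph of H" is rendered as
-- an injective morphism from G to H.
record _↪_ {ℒ : Alphabet} (G H : Graph ℒ) : Set where
  field
    morphism          : Morphism G H
  open Morphism morphism public
  field
    onNodes-injective : Injective _≡_ _≡_ onNodes
    onEdges-injective : Injective _≡_ _≡_ onEdges

open _↪_

record _≅_ {ℒ : Alphabet} (G H : Graph ℒ) : Set where
  field
    injection          : G ↪ H
    onNodes-surjective : Surjective _≡_ _≡_ (onNodes injection)
    onEdges-surjective : Surjective _≡_ _≡_ (onEdges injection)

open _≅_

_≗_ : {ℒ : Alphabet} {G H : Graph ℒ} → G ↪ H → G ↪ H → Set
f ≗ g = (∀ v → onNodes f v ≡ onNodes g v) × (∀ e → onEdges f e ≡ onEdges g e)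

_∈Im_ : {A B : Set} → B → (A → B) → Set
y ∈Im f = ∃[ x ] f x ≡ y

-- y ∈ f(B ∖ i(A))
_∈Im_∖_ : {A B C : Set} → C → (B → C) → (A → B) → Set
y ∈Im f ∖ i = ∃[ x ] (¬ (x ∈Im i) × f x ≡ y)

record Rule (ℒ : Alphabet) : Set₁ where
  field
    L K R : Graph ℒ
    K⊆L   : K ↪ L
    K⊆R   : K ↪ R

open Rule

Dangling : {ℒ : Alphabet} (r : Rule ℒ) {G : Graph ℒ} → L r ↪ G → Set
Dangling r {G} g = ∀ e → ¬ (e ∈Im onEdges g) →
  ¬ (source G e ∈Im onNodes g ∖ onNodes (K⊆L r)) ×
  ¬ (target G e ∈Im onNodes g ∖ onNodes (K⊆L r))

-- For j : K ↪ X and f : X ↪ G, the subgraph i : D ↪ G is G ∖ f(X ∖ K).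
record IsRemainder {ℒ : Alphabet} {K X G D : Graph ℒ}
                   (j : K ↪ X) (f : X ↪ G) (i : D ↪ G) : Set where
  field
    remainingNodes : ∀ v → v ∈Im onNodes i ⇔ (¬ (v ∈Im onNodes f ∖ onNodes j))
    remainingEdges : ∀ e → e ∈Im onEdges i ⇔ (¬ (e ∈Im onEdges f ∖ onEdges j))

-- G ⇒_{r,g} H.  The graph D is G ∖ g(L ∖ K).  The graph H is specified, up to
-- isomorphism, as D together with a disjoint copy h(R ∖ K) of R ∖ K, attached
-- to D along K: this is IsRemainder for the comatch h (which is injective)
-- together with the agreement of g and h on K.
record DirectDerivation {ℒ : Alphabet} (r : Rule ℒ) {G : Graph ℒ} (g : L r ↪ G)
                        (H : Graph ℒ) : Set₁ where
  field
    dangling : Dangling r g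
    D        : Graph ℒ
    D⊆G      : D ↪ G
    deletion : IsRemainder (K⊆L r) g D⊆G
    D⊆H      : D ↪ H
    comatch  : R r ↪ H
    addition : IsRemainder (K⊆R r) comatch D⊆H
    agreeOnNodes : ∀ k d → onNodes D⊆G d ≡ onNodes g (onNodes (K⊆L r) k) →
                           onNodes D⊆H d ≡ onNodes comatch (onNodes (K⊆R r) k)
    agreeOnEdges : ∀ k d → onEdges D⊆G d ≡ onEdges g (onEdges (K⊆L r) k) →
                           onEdges D⊆H d ≡ onEdges comatch (onEdges (K⊆R r) k)

-- The rule set is enumerated without repetition, so two rules are equal
-- exactly when their indices are.
record GTSystem : Set₁ where
  field
    alphabet       : Alphabet
    #rules         : ℕ
    rule           : Fin #rules → Rule alphabet
    rule-injective : Injective _≡_ _≡_ rule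

open GTSystem

record Step (T : GTSystem) (G H : Graph (alphabet T)) : Set₁ where
  field
    index      : Fin (#rules T)
    match      : L (rule T index) ↪ G
    derivation : DirectDerivation (rule T index) match H

  usedRule : Rule (alphabet T)
  usedRule = rule T index

  open DirectDerivation derivation public

open Step

-- Derivations are taken up to isomorphism: a derivation of length 0 is an
-- isomorphism.
data Derivation (T : GTSystem) : (G H : Graph (alphabet T)) → Set₁ where
  iso : ∀ {G H} → G ≅ H → Derivation T G H
  _◅_ : ∀ {G H M} → Step T G H → Derivation T H M → Derivation T G M

-- The node component of the track morphism, a partial map represented by its
-- graph: StepTrack d v w says that the track is defined at v with value w.
StepTrack : {T : GTSystem} {G H : Graph (alphabet T)} →
            Step T G H → Node G → Node H → Set
StepTrack d v w = ∃[ x ] (onNodes (D⊆G d) x ≡ v × onNodes (D⊆H d) x ≡ w)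

data Track {T : GTSystem} : {G H : Graph (alphabet T)} →
           Derivation T G H → Node G → Node H → Set₁ where
  iso : ∀ {G H} (φ : G ≅ H) v → Track (iso φ) v (onNodes (injection φ) v)
  _◅_ : ∀ {G H M} {d : Step T G H} {ds : Derivation T H M} {u v w} →
        StepTrack d u v → Track ds v w → Track (d ◅ ds) u w

module _ {T : GTSystem} {G H₁ H₂ : Graph (alphabet T)}
         (d₁ : Step T G H₁) (d₂ : Step T G H₂) where

  ParallellyIndependent : Set
  ParallellyIndependent =
    (∀ v → v ∈Im onNodes (match d₁) → v ∈Im onNodes (match d₂) →
      v ∈Im (onNodes (match d₁) ∘ onNodes (K⊆L (usedRule d₁))) ×
      v ∈Im (onNodes (match d₂) ∘ onNodes (K⊆L (usedRule d₂)))) ×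
    (∀ e → e ∈Im onEdges (match d₁) → e ∈Im onEdges (match d₂) →
      e ∈Im (onEdges (match d₁) ∘ onEdges (K⊆L (usedRule d₁))) ×
      e ∈Im (onEdges (match d₂) ∘ onEdges (K⊆L (usedRule d₂))))

  record CriticalPair : Set where
    field
      coverNodes : ∀ v → v ∈Im onNodes (match d₁) ⊎ v ∈Im onNodes (match d₂)
      coverEdges : ∀ e → e ∈Im onEdges (match d₁) ⊎ e ∈Im onEdges (match d₂)
      conflict   : ¬ ParallellyIndependent
      distinct   : (eq : index d₁ ≡ index d₂) →
                   ¬ (subst (λ i → L (rule T i) ↪ G) eq (match d₁) ≗ match d₂)

  Persistent : Node G → Set
  Persistent v = ∃ (StepTrack d₁ v) × ∃ (StepTrack d₂ v)

  StronglyJoinable : Set₁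
  StronglyJoinable =
    Σ[ M ∈ Graph (alphabet T) ]
    Σ[ ds₁ ∈ Derivation T H₁ M ]
    Σ[ ds₂ ∈ Derivation T H₂ M ]
    (∀ v → Persistent v → ∃[ w ] (Track (d₁ ◅ ds₁) v w × Track (d₂ ◅ ds₂) v w))

-- A set of isomorphism classes, as an isomorphism-invariant predicate.
record GraphSet (ℒ : Alphabet) (ℓ : Level) : Set (lsuc ℓ) where
  field
    Member     : Pred (Graph ℒ) ℓ
    respects-≅ : Member Respects _≅_

open GraphSet

-- Closed under isomorphism as well, an isomorphism being a special case of _↪_.
data SubgraphClosure {ℒ : Alphabet} {ℓ : Level} (𝐃 : GraphSet ℒ ℓ) :
                     Pred (Graph ℒ) (lsuc lzero ⊔ ℓ) where
  base     : ∀ {G} → Member 𝐃 G → SubgraphClosure 𝐃 G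
  subgraph : ∀ {G H} → SubgraphClosure 𝐃 G → H ↪ G → SubgraphClosure 𝐃 H

-- For a critical pair with common source G.
NonGarbage : {ℒ : Alphabet} {ℓ : Level} → GraphSet ℒ ℓ → Graph ℒ → Set (lsuc lzero ⊔ ℓ)
NonGarbage 𝐃 G = SubgraphClosure 𝐃 G

NonGarbageCriticalPairsStronglyJoinable :
  (T : GTSystem) {ℓ : Level} → GraphSet (alphabet T) ℓ → Set (lsuc lzero ⊔ ℓ)
NonGarbageCriticalPairsStronglyJoinable T 𝐃 =
  ∀ {G H₁ H₂} (d₁ : Step T G H₁) (d₂ : Step T G H₂) →
  CriticalPair d₁ d₂ → NonGarbage 𝐃 G → StronglyJoinable d₁ d₂

Joinable : (T : GTSystem) → Graph (alphabet T) → Graph (alphabet T) → Set₁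
Joinable T H₁ H₂ =
  Σ[ M ∈ Graph (alphabet T) ] (Derivation T H₁ M × Derivation T H₂ M)

LocallyConfluentOn : (T : GTSystem) {ℓ : Level} → GraphSet (alphabet T) ℓ → Set (lsuc lzero ⊔ ℓ)
LocallyConfluentOn T 𝐃 =
  ∀ {G H₁ H₂} → Member 𝐃 G → Step T G H₁ → Step T G H₂ → Joinable T H₁ H₂

{-# OPTIONS --safe #-}

-- Let H₁ ⇐ G ⇒ H₂ use matches g₁, g₂.  If these are the same match of the same
-- rule, then H₁ ≅ H₂.  If the steps are parallelly independent, with contexts
-- D₁, D₂ ⊆ G, put S = D₁ ∩ D₂ and E_i = R_i +_{K_i} S; then E₁ +_S E₂ is a
-- common reduct.  Otherwise the steps restrict to a critical pair on
-- U = g₁(L₁) ∪ g₂(L₂), which is non-garbage because U ⊆ G.  By the dangling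
-- condition, the edges of G outside U meet U only in persistent nodes, so
-- G = U +_B C with B the discrete graph of the persistent nodes.  Along the
-- derivations joining the critical pair B survives, and its two tracks into
-- the common reduct M agree; gluing C to every graph along B therefore joins
-- H₁ and H₂ in M +_B C.
--
-- All graph morphisms in this argument are injective, and a pushout square of
-- such maps can be recognised separately on nodes and on edges.

module Submission where

open import Data.Empty using (⊥; ⊥-elim)
import Data.Fin.Properties as Fin
open import Data.Fin.Base using (Fin; zero; suc)
open import Data.List.Base using (List; []; _∷_; lookup; length; filter; tabulate)
open import Data.List.Membership.Propositional using (_∈_)
open import Data.List.Membership.Propositional.Properties using (∈-filter⁺; ∈-filter⁻; ∈-tabulate⁺; ∈-lookup)
import Data.List.Relation.Unary.All as All
open import Data.List.Relation.Unary.AllPairs using (_∷_)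
open import Data.List.Relation.Unary.Any using (index)
open import Data.List.Relation.Unary.Any.Properties using (lookup-index)
open import Data.List.Relation.Unary.Unique.Propositional using (Unique)
import Data.List.Relation.Unary.Unique.Propositional.Properties as Unique
open import Data.Product.Base using (∃; ∃-syntax; Σ-syntax; _×_; _,_; proj₁; proj₂)
open import Data.Sum.Base using (_⊎_; inj₁; inj₂; [_,_]; [_,_]′)
open import Data.Sum.Function.Propositional using (_⊎-↔_)
open import Data.Sum.Properties using (inj₁-injective; inj₂-injective)
open import Function.Base using (_∘_; id)
open import Function.Bundles using (_⇔_; mk⇔; Inverse; Equivalence)
open import Function.Definitions using (Injective; Surjective)
open import Function.Properties.Inverse using (↔-refl; ↔-sym; ↔-trans)
open import Level using (Level; 0ℓ)
open import Relation.Binary.Definitions using (DecidableEquality)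
open import Relation.Binary.PropositionalEquality using (_≡_; refl; sym; trans; cong; subst)
open import Relation.Nullary.Decidable.Core using (Dec; yes; no; map′; ¬?; _×-dec_; _⊎-dec_; _→-dec_)
open import Relation.Nullary.Negation.Core using (¬_; contradiction)
open import Relation.Unary using (Pred; Decidable)

open import Defs

open FiniteSet
open Graph
open _↪_
open _≅_
open Rule
open GTSystem

-- Finite sets

from∘to : (A : FiniteSet) → ∀ a → Inverse.from (enumeration A) (Inverse.to (enumeration A) a) ≡ a
from∘to A = Inverse.strictlyInverseʳ (enumeration A)

to∘from : (A : FiniteSet) → ∀ i → Inverse.to (enumeration A) (Inverse.from (enumeration A) i) ≡ i
to∘from A = Inverse.strictlyInverseˡ (enumeration A)

_≟_ : {A : FiniteSet} → DecidableEquality (Carrier A)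
_≟_ {A} a b = map′
  (λ eq → trans (sym (from∘to A a)) (trans (cong (Inverse.from (enumeration A)) eq) (from∘to A b)))
  (cong (Inverse.to (enumeration A)))
  (Inverse.to (enumeration A) a Fin.≟ Inverse.to (enumeration A) b)

module _ (A : FiniteSet) {P : Pred (Carrier A) 0ℓ} (P? : Decidable P) where

  any? : Dec (∃ P)
  any? = map′ (λ (i , p) → Inverse.from (enumeration A) i , p)
              (λ (a , p) → Inverse.to (enumeration A) a , subst P (sym (from∘to A a)) p)
              (Fin.any? (P? ∘ Inverse.from (enumeration A)))

  all? : Dec (∀ a → P a)
  all? = map′ (λ p a → subst P (from∘to A a) (p (Inverse.to (enumeration A) a)))
              (λ p i → p (Inverse.from (enumeration A) i))
              (Fin.all? (P? ∘ Inverse.from (enumeration A)))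

∈Im? : (A B : FiniteSet) (f : Carrier A → Carrier B) → Decidable (_∈Im f)
∈Im? A B f b = any? A (λ a → _≟_ {B} (f a) b)

lookup-injective : {A : Set} {xs : List A} → Unique xs → Injective _≡_ _≡_ (lookup xs)
lookup-injective {xs = _ ∷ _} (_ ∷ _)  {zero}  {zero}  _  = refl
lookup-injective {xs = _ ∷ _} (p ∷ _)  {zero}  {suc j} eq = contradiction eq (All.lookup p (∈-lookup j))
lookup-injective {xs = _ ∷ _} (p ∷ _)  {suc i} {zero}  eq = contradiction (sym eq) (All.lookup p (∈-lookup i))
lookup-injective {xs = _ ∷ _} (_ ∷ ps) {suc i} {suc j} eq = cong suc (lookup-injective ps eq)

record Subset (A : FiniteSet) (P : Pred (Carrier A) 0ℓ) : Set₁ where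
  field
    set       : FiniteSet
    inclusion : Carrier set → Carrier A
    injective : Injective _≡_ _≡_ inclusion
    image     : ∀ a → a ∈Im inclusion ⇔ P a

-- The carrier consists of positions in the duplicate-free list of members rather than of elements
-- paired with proofs of `P`: an element may have several such proofs, but it has exactly one
-- position.
comprehension : (A : FiniteSet) {P : Pred (Carrier A) 0ℓ} → Decidable P → Subset A P
comprehension A {P} P? = record
  { set       = record { Carrier = Fin (length members) ; size = length members ; enumeration = ↔-refl }
  ; inclusion = lookup members
  ; injective = lookup-injective (Unique.filter⁺ P? (Unique.tabulate⁺ from-injective))
  ; image     = λ a → mk⇔
      (λ (i , eq) → subst P eq (proj₂ (∈-filter⁻ P? {xs = elements} (∈-lookup i))))
      (λ p → let a∈ = ∈-filter⁺ P? (subst (_∈ elements) (from∘to A a) (∈-tabulate⁺ (Inverse.to (enumeration A) a))) p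
             in index a∈ , sym (lookup-index a∈))
  }
  where
  elements : List (Carrier A)
  elements = tabulate (Inverse.from (enumeration A))
  members : List (Carrier A)
  members = filter P? elements
  from-injective : Injective _≡_ _≡_ (Inverse.from (enumeration A))
  from-injective {i} {j} eq =
    trans (sym (to∘from A i)) (trans (cong (Inverse.to (enumeration A)) eq) (to∘from A j))

disjointUnion : FiniteSet → FiniteSet → FiniteSet
disjointUnion A B = record
  { enumeration = ↔-trans (enumeration A ⊎-↔ enumeration B) (↔-sym Fin.+↔⊎) }

-- Gluing of sets along injections

-- For injective maps, a pushout square that is also a pullback.
record IsGluing {K X D G : Set} (j : K → X) (m : K → D) (f : X → G) (i : D → G) : Set where
  field
    commute : ∀ k → f (j k) ≡ i (m k)
    meet    : ∀ {x d} → f x ≡ i d → ∃[ k ] (j k ≡ x × m k ≡ d)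
    cover   : ∀ y → y ∈Im f ⊎ y ∈Im i

open IsGluing

swapGluing : {K X D G : Set} {j : K → X} {m : K → D} {f : X → G} {i : D → G} →
             IsGluing j m f i → IsGluing m j i f
swapGluing p = record
  { commute = λ k → sym (commute p k)
  ; meet    = λ eq → let (k , a , b) = meet p (sym eq) in k , b , a
  ; cover   = λ y → [ inj₂ , inj₁ ]′ (cover p y)
  }

pasteGluing : {K X D G D′ G′ : Set} {j : K → X} {m : K → D} {f : X → G} {i : D → G}
              {u : D → D′} {v : G → G′} {w : D′ → G′} →
              IsGluing j m f i → IsGluing i u v w → IsGluing j (u ∘ m) (v ∘ f) w
pasteGluing {G′ = G′} {f = f} {u = u} {v = v} {w = w} p q = record
  { commute = λ k → trans (cong v (commute p k)) (commute q _)
  ; meet    = λ eq → let (d , i≡ , u≡) = meet q eq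
                         (k , j≡ , m≡) = meet p (sym i≡)
                     in k , j≡ , trans (cong u m≡) u≡
  ; cover   = λ y → [ (λ (g , eq) → covered g eq) , inj₂ ]′ (cover q y)
  }
  where
  covered : ∀ {y : G′} g → v g ≡ y → y ∈Im (v ∘ f) ⊎ y ∈Im w
  covered g eq with cover p g
  ... | inj₁ (x , f≡) = inj₁ (x , trans (cong v f≡) eq)
  ... | inj₂ (d , i≡) = inj₂ (u d , trans (sym (commute q d)) (trans (cong v i≡) eq))

-- Decomposition of a pasted square. If `v g` equals `w d′`, then either `g` comes from D, and
-- injectivity of `w` gives the rest, or `g` is some `f x`; the outer square then traces `x` back to
-- K, so `g` comes from D after all.
unpasteGluing : {K X D G D′ G′ : Set} {j : K → X} {m : K → D} {f : X → G} {i : D → G}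
                {u : D → D′} {m′ : K → D′} {v : G → G′} {f′ : X → G′} {w : D′ → G′} →
                IsGluing j m f i → IsGluing j m′ f′ w → Injective _≡_ _≡_ w →
                (∀ k → u (m k) ≡ m′ k) → (∀ x → v (f x) ≡ f′ x) → (∀ d → v (i d) ≡ w (u d)) →
                IsGluing i u v w
unpasteGluing {D = D} {f = f} {i = i} {u = u} {v = v} {w = w} p q w-injective um vf vi = record
  { commute = vi
  ; meet    = met
  ; cover   = λ y → [ (λ (x , eq) → inj₁ (f x , trans (vf x) eq)) , inj₂ ]′ (cover q y)
  }
  where
  met : ∀ {g d′} → v g ≡ w d′ → ∃[ d ] (i d ≡ g × u d ≡ d′)
  met {g} eq with cover p g
  ... | inj₂ (d , i≡) = d , i≡ , w-injective (trans (sym (vi d)) (trans (cong v i≡) eq))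
  ... | inj₁ (x , f≡) =
    let (k , j≡ , m≡) = meet q (trans (sym (vf x)) (trans (cong v f≡) eq))
    in _ , trans (sym (commute p k)) (trans (cong f j≡) f≡) , trans (um k) m≡

gluing-elim : {K X D G : Set} {j : K → X} {m : K → D} {f : X → G} {i : D → G} →
              IsGluing j m f i → {Q : Pred G 0ℓ} → (∀ x → Q (f x)) → (∀ d → Q (i d)) → ∀ y → Q y
gluing-elim p {Q} s t y = [ (λ (x , eq) → subst Q eq (s x)) , (λ (d , eq) → subst Q eq (t d)) ]′ (cover p y)

module _ {K X D G Z : Set} {j : K → X} {m : K → D} {f : X → G} {i : D → G}
         (p : IsGluing j m f i) (s : X → Z) (t : D → Z) where

  -- The value is taken at whichever preimage `cover` returns; `copair-left` and `copair-right` show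
  -- when this choice does not matter.
  copair : G → Z
  copair y = [ s ∘ proj₁ , t ∘ proj₁ ]′ (cover p y)

  module _ (agree : ∀ k → s (j k) ≡ t (m k)) where

    copair-left : Injective _≡_ _≡_ f → ∀ x → copair (f x) ≡ s x
    copair-left f-injective x with cover p (f x)
    ... | inj₁ (x′ , eq) = cong s (f-injective eq)
    ... | inj₂ (d , eq) = let (k , j≡ , m≡) = meet p (sym eq)
      in trans (cong t (sym m≡)) (trans (sym (agree k)) (cong s j≡))

    copair-right : Injective _≡_ _≡_ i → ∀ d → copair (i d) ≡ t d
    copair-right i-injective d with cover p (i d)
    ... | inj₁ (x , eq) = let (k , j≡ , m≡) = meet p eq
      in trans (cong s (sym j≡)) (trans (agree k) (cong t m≡))
    ... | inj₂ (d′ , eq) = cong t (i-injective eq)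

    -- Points of the same piece are separated by `s` or by `t`. Points of different pieces with the
    -- same value come from one point of K by `meets`, so they already coincide in G.
    copair-injective : Injective _≡_ _≡_ s → Injective _≡_ _≡_ t →
                       (∀ {x d} → s x ≡ t d → ∃[ k ] (j k ≡ x × m k ≡ d)) →
                       Injective _≡_ _≡_ copair
    copair-injective s-injective t-injective meets {y} {y′} eq with cover p y | cover p y′
    ... | inj₁ (x , y≡) | inj₁ (x′ , y′≡) = trans (sym y≡) (trans (cong f (s-injective eq)) y′≡)
    ... | inj₂ (d , y≡) | inj₂ (d′ , y′≡) = trans (sym y≡) (trans (cong i (t-injective eq)) y′≡)
    ... | inj₁ (x , y≡) | inj₂ (d , y′≡) = let (k , j≡ , m≡) = meets eq in
      trans (sym y≡) (trans (cong f (sym j≡)) (trans (commute p k) (trans (cong i m≡) y′≡)))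
    ... | inj₂ (d , y≡) | inj₁ (x , y′≡) = let (k , j≡ , m≡) = meets (sym eq) in
      trans (sym y≡) (trans (cong i (sym m≡)) (trans (sym (commute p k)) (trans (cong f j≡) y′≡)))

record Amalgam {K : Set} (X D : FiniteSet) (j : K → Carrier X) (m : K → Carrier D) : Set₁ where
  field
    set             : FiniteSet
    left            : Carrier X → Carrier set
    right           : Carrier D → Carrier set
    left-injective  : Injective _≡_ _≡_ left
    right-injective : Injective _≡_ _≡_ right
    isGluing        : IsGluing j m left right

-- For injective maps the quotient of the disjoint union has a normal form: all of X, together with
-- the points of D outside the image of `m`.
amalgam : (K X D : FiniteSet) {j : Carrier K → Carrier X} {m : Carrier K → Carrier D} →
          Injective _≡_ _≡_ j → Injective _≡_ _≡_ m → Amalgam X D j m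
amalgam K X D {j} {m} j-injective m-injective = record
  { set             = disjointUnion X (Subset.set fresh)
  ; left            = inj₁
  ; right           = right
  ; left-injective  = inj₁-injective
  ; right-injective = copair-injective split (inj₁ ∘ j) inj₂ (λ ())
                        (λ eq → j-injective (inj₁-injective eq)) inj₂-injective (λ ())
  ; isGluing        = record
      { commute = λ k → sym (right-m k)
      ; meet    = met
      ; cover   = [ (λ x → inj₁ (x , refl)) , (λ c → inj₂ (κ c , right-κ c)) ]
      }
  }
  where
  fresh : Subset D (λ d → ¬ (d ∈Im m))
  fresh = comprehension D (λ d → ¬? (∈Im? K D m d))
  κ : Carrier (Subset.set fresh) → Carrier D
  κ = Subset.inclusion fresh
  -- D is the disjoint union of the image of `m` and the fresh points. Read as a gluing along the
  -- empty set, this makes `right` a `copair`, whose injectivity is already known.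
  split : IsGluing {K = ⊥} (λ ()) (λ ()) m κ
  split = record
    { commute = λ ()
    ; meet    = λ {k} {c} eq → contradiction (k , eq) (Equivalence.to (Subset.image fresh (κ c)) (c , refl))
    ; cover   = covered
    }
    where
    covered : ∀ d → d ∈Im m ⊎ d ∈Im κ
    covered d with ∈Im? K D m d
    ... | yes d∈ = inj₁ d∈
    ... | no  d∉ = inj₂ (Equivalence.from (Subset.image fresh d) d∉)
  right : Carrier D → Carrier X ⊎ Carrier (Subset.set fresh)
  right = copair split (inj₁ ∘ j) inj₂
  right-m : ∀ k → right (m k) ≡ inj₁ (j k)
  right-m = copair-left split (inj₁ ∘ j) inj₂ (λ ()) m-injective
  right-κ : ∀ c → right (κ c) ≡ inj₂ c
  right-κ = copair-right split (inj₁ ∘ j) inj₂ (λ ()) (Subset.injective fresh)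
  met : ∀ {x d} → inj₁ x ≡ right d → ∃[ k ] (j k ≡ x × m k ≡ d)
  met {x} {d} eq with cover split d
  met {x} {d} eq | inj₁ (k , m≡) = k , sym (inj₁-injective eq) , m≡
  met {x} {d} () | inj₂ _

-- A point of X whose image survives in D must come from K, because the images of all other points
-- of X were removed. A point outside the image of `f` was not removed, so it lies in D.
remainder⇒gluing : {K X D G : FiniteSet}
  {j : Carrier K → Carrier X} {m : Carrier K → Carrier D}
  {f : Carrier X → Carrier G} {i : Carrier D → Carrier G} → Injective _≡_ _≡_ i →
  (∀ k → f (j k) ≡ i (m k)) → (∀ y → y ∈Im i ⇔ (¬ (y ∈Im f ∖ j))) → IsGluing j m f i
remainder⇒gluing {K} {X} {D} {G} {j} {m} {f} {i} i-injective commutes remaining = record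
  { commute = commutes ; meet = met ; cover = covered }
  where
  met : ∀ {x d} → f x ≡ i d → ∃[ k ] (j k ≡ x × m k ≡ d)
  met {x} {d} eq with ∈Im? K X j x
  ... | yes (k , j≡) = k , j≡ , i-injective (trans (sym (commutes k)) (trans (cong f j≡) eq))
  ... | no x∉ = contradiction (x , x∉ , eq) (Equivalence.to (remaining (i d)) (d , refl))
  covered : ∀ y → y ∈Im f ⊎ y ∈Im i
  covered y with ∈Im? X G f y
  ... | yes y∈ = inj₁ y∈
  ... | no  y∉ = inj₂ (Equivalence.from (remaining y) (λ (x , _ , eq) → y∉ (x , eq)))

-- That `f x` was not removed says only that `x` is not outside the image of `j`; the decision `∈j?`
-- turns this into a preimage in K, which `m` carries into D.
gluing⇒remainder : {K X D G : Set} {j : K → X} {m : K → D} {f : X → G} {i : D → G} →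
  (∀ x → Dec (x ∈Im j)) → IsGluing j m f i → ∀ y → y ∈Im i ⇔ (¬ (y ∈Im f ∖ j))
gluing⇒remainder {j = j} {m} {f} {i} ∈j? p y = mk⇔
  (λ (d , i≡) (x , x∉ , f≡) → let (k , j≡ , _) = meet p (trans f≡ (sym i≡)) in x∉ (k , j≡))
  remains
  where
  remains : ¬ (y ∈Im f ∖ j) → y ∈Im i
  remains y∉ with cover p y
  ... | inj₂ y∈i = y∈i
  ... | inj₁ (x , f≡) with ∈j? x
  ...   | yes (k , j≡) = m k , trans (sym (commute p k)) (trans (cong f j≡) f≡)
  ...   | no x∉ = contradiction (x , x∉ , f≡) y∉

-- Gluing of graphs

private
  variable
    ℒ : Alphabet
    B X D G D′ G′ : Graph ℒ

infixr 9 _∙_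

_∙_ : G ↪ G′ → X ↪ G → X ↪ G′
_∙_ g f = record
  { morphism = record
      { onNodes     = onNodes g ∘ onNodes f
      ; onEdges     = onEdges g ∘ onEdges f
      ; source-≡    = λ e → trans (source-≡ g _) (cong (onNodes g) (source-≡ f e))
      ; target-≡    = λ e → trans (target-≡ g _) (cong (onNodes g) (target-≡ f e))
      ; nodeLabel-≡ = λ v → trans (nodeLabel-≡ g _) (nodeLabel-≡ f v)
      ; edgeLabel-≡ = λ e → trans (edgeLabel-≡ g _) (edgeLabel-≡ f e)
      }
  ; onNodes-injective = onNodes-injective f ∘ onNodes-injective g
  ; onEdges-injective = onEdges-injective f ∘ onEdges-injective g
  }

≅-refl : G ≅ G
≅-refl = record
  { injection = record
      { morphism = record
          { onNodes = id ; onEdges = id ; source-≡ = λ _ → refl ; target-≡ = λ _ → refl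
          ; nodeLabel-≡ = λ _ → refl ; edgeLabel-≡ = λ _ → refl }
      ; onNodes-injective = id
      ; onEdges-injective = id
      }
  ; onNodes-surjective = λ v → v , λ eq → eq
  ; onEdges-surjective = λ e → e , λ eq → eq
  }

-- Preimages under `i` are unique, so those supplied by `ns` and `es` automatically respect
-- endpoints and labels.
lift : (f : X ↪ G) (i : D ↪ G) → (∀ v → onNodes f v ∈Im onNodes i) →
       (∀ e → onEdges f e ∈Im onEdges i) → X ↪ D
lift {G = G} f i ns es = record
  { morphism = record
      { onNodes     = proj₁ ∘ ns
      ; onEdges     = proj₁ ∘ es
      ; source-≡    = λ e → onNodes-injective i (trans (sym (source-≡ i _))
          (trans (cong (source G) (proj₂ (es e))) (trans (source-≡ f e) (sym (proj₂ (ns _))))))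
      ; target-≡    = λ e → onNodes-injective i (trans (sym (target-≡ i _))
          (trans (cong (target G) (proj₂ (es e))) (trans (target-≡ f e) (sym (proj₂ (ns _))))))
      ; nodeLabel-≡ = λ v → trans (sym (nodeLabel-≡ i _))
          (trans (cong (nodeLabel G) (proj₂ (ns v))) (nodeLabel-≡ f v))
      ; edgeLabel-≡ = λ e → trans (sym (edgeLabel-≡ i _))
          (trans (cong (edgeLabel G) (proj₂ (es e))) (edgeLabel-≡ f e))
      }
  ; onNodes-injective = λ {v} {w} eq → onNodes-injective f
      (trans (sym (proj₂ (ns v))) (trans (cong (onNodes i) eq) (proj₂ (ns w))))
  ; onEdges-injective = λ {e} {e′} eq → onEdges-injective f
      (trans (sym (proj₂ (es e))) (trans (cong (onEdges i) eq) (proj₂ (es e′))))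
  }

sourceIn : (f : X ↪ G) {e : Edge G} → e ∈Im onEdges f → source G e ∈Im onNodes f
sourceIn {X = X} {G} f (e , eq) = source X e , trans (sym (source-≡ f e)) (cong (source G) eq)

targetIn : (f : X ↪ G) {e : Edge G} → e ∈Im onEdges f → target G e ∈Im onNodes f
targetIn {X = X} {G} f (e , eq) = target X e , trans (sym (target-≡ f e)) (cong (target G) eq)

record Subgraph (G : Graph ℒ) (P : Pred (Node G) 0ℓ) (Q : Pred (Edge G) 0ℓ) : Set₁ where
  field
    graph     : Graph ℒ
    inclusion : graph ↪ G
    nodeImage : ∀ v → v ∈Im onNodes inclusion ⇔ P v
    edgeImage : ∀ e → e ∈Im onEdges inclusion ⇔ Q e

open Subgraph

subgraphOn : (G : Graph ℒ) {P : Pred (Node G) 0ℓ} {Q : Pred (Edge G) 0ℓ} →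
             Decidable P → Decidable Q →
             (∀ e → Q e → P (source G e)) → (∀ e → Q e → P (target G e)) → Subgraph G P Q
subgraphOn G {P} {Q} P? Q? sourceClosed targetClosed = record
  { graph = record
      { nodes     = Subset.set N
      ; edges     = Subset.set E
      ; source    = proj₁ ∘ sourceOf
      ; target    = proj₁ ∘ targetOf
      ; nodeLabel = nodeLabel G ∘ Subset.inclusion N
      ; edgeLabel = edgeLabel G ∘ Subset.inclusion E
      }
  ; inclusion = record
      { morphism = record
          { onNodes     = Subset.inclusion N
          ; onEdges     = Subset.inclusion E
          ; source-≡    = λ e → sym (proj₂ (sourceOf e))
          ; target-≡    = λ e → sym (proj₂ (targetOf e))
          ; nodeLabel-≡ = λ _ → refl
          ; edgeLabel-≡ = λ _ → refl
          }
      ; onNodes-injective = Subset.injective N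
      ; onEdges-injective = Subset.injective E
      }
  ; nodeImage = Subset.image N
  ; edgeImage = Subset.image E
  }
  where
  N : Subset (nodes G) P
  N = comprehension (nodes G) P?
  E : Subset (edges G) Q
  E = comprehension (edges G) Q?
  member : ∀ e → Q (Subset.inclusion E e)
  member e = Equivalence.to (Subset.image E _) (e , refl)
  sourceOf : ∀ e → source G (Subset.inclusion E e) ∈Im Subset.inclusion N
  sourceOf e = Equivalence.from (Subset.image N _) (sourceClosed _ (member e))
  targetOf : ∀ e → target G (Subset.inclusion E e) ∈Im Subset.inclusion N
  targetOf e = Equivalence.from (Subset.image N _) (targetClosed _ (member e))

record IsPushout {B X D G : Graph ℒ} (j : B ↪ X) (m : B ↪ D) (f : X ↪ G) (i : D ↪ G) : Set where
  field
    nodeGluing : IsGluing (onNodes j) (onNodes m) (onNodes f) (onNodes i)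
    edgeGluing : IsGluing (onEdges j) (onEdges m) (onEdges f) (onEdges i)

open IsPushout

swap : {j : B ↪ X} {m : B ↪ D} {f : X ↪ G} {i : D ↪ G} → IsPushout j m f i → IsPushout m j i f
swap p = record
  { nodeGluing = swapGluing (nodeGluing p)
  ; edgeGluing = swapGluing (edgeGluing p)
  }

paste : {j : B ↪ X} {m : B ↪ D} {f : X ↪ G} {i : D ↪ G} {u : D ↪ D′} {v : G ↪ G′} {w : D′ ↪ G′} →
        IsPushout j m f i → IsPushout i u v w → IsPushout j (u ∙ m) (v ∙ f) w
paste p q = record
  { nodeGluing = pasteGluing (nodeGluing p) (nodeGluing q)
  ; edgeGluing = pasteGluing (edgeGluing p) (edgeGluing q)
  }

record Pushout (j : B ↪ X) (m : B ↪ D) : Set₁ where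
  field
    object    : Graph _
    left      : X ↪ object
    right     : D ↪ object
    isPushout : IsPushout j m left right

-- Endpoints and labels are inherited from both sides; the two prescriptions agree on B because `j`
-- and `m` are morphisms.
pushout : (j : B ↪ X) (m : B ↪ D) → Pushout j m
pushout {B = B} {X = X} {D = D} j m = record
  { object = record
      { nodes     = N.set
      ; edges     = E.set
      ; source    = copair E.isGluing (N.left ∘ source X) (N.right ∘ source D)
      ; target    = copair E.isGluing (N.left ∘ target X) (N.right ∘ target D)
      ; nodeLabel = copair N.isGluing (nodeLabel X) (nodeLabel D)
      ; edgeLabel = copair E.isGluing (edgeLabel X) (edgeLabel D)
      }
  ; left = record
      { morphism = record
          { onNodes     = N.left
          ; onEdges     = E.left
          ; source-≡    = copair-left E.isGluing (N.left ∘ source X) (N.right ∘ source D) sources E.left-injective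
          ; target-≡    = copair-left E.isGluing (N.left ∘ target X) (N.right ∘ target D) targets E.left-injective
          ; nodeLabel-≡ = copair-left N.isGluing (nodeLabel X) (nodeLabel D) nodeLabels-≡ N.left-injective
          ; edgeLabel-≡ = copair-left E.isGluing (edgeLabel X) (edgeLabel D) edgeLabels-≡ E.left-injective
          }
      ; onNodes-injective = N.left-injective
      ; onEdges-injective = E.left-injective
      }
  ; right = record
      { morphism = record
          { onNodes     = N.right
          ; onEdges     = E.right
          ; source-≡    = copair-right E.isGluing (N.left ∘ source X) (N.right ∘ source D) sources E.right-injective
          ; target-≡    = copair-right E.isGluing (N.left ∘ target X) (N.right ∘ target D) targets E.right-injective
          ; nodeLabel-≡ = copair-right N.isGluing (nodeLabel X) (nodeLabel D) nodeLabels-≡ N.right-injective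
          ; edgeLabel-≡ = copair-right E.isGluing (edgeLabel X) (edgeLabel D) edgeLabels-≡ E.right-injective
          }
      ; onNodes-injective = N.right-injective
      ; onEdges-injective = E.right-injective
      }
  ; isPushout = record { nodeGluing = N.isGluing ; edgeGluing = E.isGluing }
  }
  where
  module N = Amalgam (amalgam (nodes B) (nodes X) (nodes D) (onNodes-injective j) (onNodes-injective m))
  module E = Amalgam (amalgam (edges B) (edges X) (edges D) (onEdges-injective j) (onEdges-injective m))
  sources : ∀ e → N.left (source X (onEdges j e)) ≡ N.right (source D (onEdges m e))
  sources e = trans (cong N.left (source-≡ j e))
    (trans (commute N.isGluing _) (cong N.right (sym (source-≡ m e))))
  targets : ∀ e → N.left (target X (onEdges j e)) ≡ N.right (target D (onEdges m e))
  targets e = trans (cong N.left (target-≡ j e))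
    (trans (commute N.isGluing _) (cong N.right (sym (target-≡ m e))))
  nodeLabels-≡ : ∀ v → nodeLabel X (onNodes j v) ≡ nodeLabel D (onNodes m v)
  nodeLabels-≡ v = trans (nodeLabel-≡ j v) (sym (nodeLabel-≡ m v))
  edgeLabels-≡ : ∀ e → edgeLabel X (onEdges j e) ≡ edgeLabel D (onEdges m e)
  edgeLabels-≡ e = trans (edgeLabel-≡ j e) (sym (edgeLabel-≡ m e))

record Factorization {D G D′ G′ : Graph ℒ} {X : Graph ℒ} (f : X ↪ G) (i : D ↪ G) (u : D ↪ D′)
                     (f′ : X ↪ G′) (w : D′ ↪ G′) : Set where
  field
    mediator  : G ↪ G′
    left-≗    : mediator ∙ f ≗ f′
    right-≗   : mediator ∙ i ≗ w ∙ u
    isPushout : IsPushout i u mediator w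

-- A pushout along the composite of `m` and `u` splits into the pushout along `m` followed by one
-- along `u`. The mediator is induced by `f′` and `w ∙ u`, and `unpasteGluing` recognises the second
-- square.
factor : {j : B ↪ X} {m : B ↪ D} {f : X ↪ G} {i : D ↪ G} {u : D ↪ D′}
         {m′ : B ↪ D′} {f′ : X ↪ G′} {w : D′ ↪ G′} →
         IsPushout j m f i → IsPushout j m′ f′ w → u ∙ m ≗ m′ → Factorization f i u f′ w
factor {ℒ} {X = X} {D} {G} {G′ = G′} {j} {m} {f} {i} {u} {m′} {f′} {w} p q (umN , umE) = record
  { mediator = record
      { morphism = record
          { onNodes     = N.onto
          ; onEdges     = E.onto
          ; source-≡    = endpoint source source-≡
          ; target-≡    = endpoint target target-≡
          ; nodeLabel-≡ = gluing-elim (nodeGluing p)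
              (λ x → trans (cong (nodeLabel G′) (N.onto-left x)) (trans (nodeLabel-≡ f′ x) (sym (nodeLabel-≡ f x))))
              (λ d → trans (cong (nodeLabel G′) (N.onto-right d)) (trans (nodeLabel-≡ (w ∙ u) d) (sym (nodeLabel-≡ i d))))
          ; edgeLabel-≡ = gluing-elim (edgeGluing p)
              (λ x → trans (cong (edgeLabel G′) (E.onto-left x)) (trans (edgeLabel-≡ f′ x) (sym (edgeLabel-≡ f x))))
              (λ d → trans (cong (edgeLabel G′) (E.onto-right d)) (trans (edgeLabel-≡ (w ∙ u) d) (sym (edgeLabel-≡ i d))))
          }
      ; onNodes-injective = N.onto-injective
      ; onEdges-injective = E.onto-injective
      }
  ; left-≗    = N.onto-left , E.onto-left
  ; right-≗   = N.onto-right , E.onto-right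
  ; isPushout = record { nodeGluing = N.complement ; edgeGluing = E.complement }
  }
  where
  -- The argument on underlying sets, instantiated once for nodes and once for edges.
  module Onto {K X D G D′ G′ : Set} {j : K → X} {m : K → D} {f : X → G} {i : D → G} {u : D → D′}
              {m′ : K → D′} {f′ : X → G′} {w : D′ → G′}
              (p : IsGluing j m f i) (q : IsGluing j m′ f′ w) (um : ∀ k → u (m k) ≡ m′ k)
              (f-injective : Injective _≡_ _≡_ f) (i-injective : Injective _≡_ _≡_ i)
              (u-injective : Injective _≡_ _≡_ u) (f′-injective : Injective _≡_ _≡_ f′)
              (w-injective : Injective _≡_ _≡_ w) where
    onto : G → G′
    onto = copair p f′ (w ∘ u)
    agree : ∀ k → f′ (j k) ≡ w (u (m k))
    agree k = trans (commute q k) (cong w (sym (um k)))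
    onto-left : ∀ x → onto (f x) ≡ f′ x
    onto-left = copair-left p f′ (w ∘ u) agree f-injective
    onto-right : ∀ d → onto (i d) ≡ w (u d)
    onto-right = copair-right p f′ (w ∘ u) agree i-injective
    onto-injective : Injective _≡_ _≡_ onto
    onto-injective = copair-injective p f′ (w ∘ u) agree f′-injective (u-injective ∘ w-injective)
      (λ eq → let (k , j≡ , m≡) = meet q eq in k , j≡ , u-injective (trans (um k) m≡))
    complement : IsGluing i u onto w
    complement = unpasteGluing p q w-injective um onto-left onto-right
  module N = Onto (nodeGluing p) (nodeGluing q) umN (onNodes-injective f) (onNodes-injective i)
    (onNodes-injective u) (onNodes-injective f′) (onNodes-injective w)
  module E = Onto (edgeGluing p) (edgeGluing q) umE (onEdges-injective f) (onEdges-injective i)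
    (onEdges-injective u) (onEdges-injective f′) (onEdges-injective w)
  -- Sources and targets behave alike; `end` stands for either of them, here and in later proofs.
  endpoint : (end : (A : Graph ℒ) → Edge A → Node A) →
             (∀ {A B} (h : A ↪ B) e → end B (onEdges h e) ≡ onNodes h (end A e)) →
             ∀ e → end G′ (E.onto e) ≡ N.onto (end G e)
  endpoint end end-≡ = gluing-elim (edgeGluing p)
    (λ x → trans (cong (end G′) (E.onto-left x)) (trans (end-≡ f′ x)
      (trans (sym (N.onto-left (end X x))) (cong N.onto (sym (end-≡ f x))))))
    (λ d → trans (cong (end G′) (E.onto-right d)) (trans (end-≡ (w ∙ u) d)
      (trans (sym (N.onto-right (end D d))) (cong N.onto (sym (end-≡ i d))))))

-- Isomorphisms are stable under pushout: a point `w d′` with `d′` equal to `u d` is `v (i d)`, so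
-- `v` is surjective whenever `u` is.
retract : {i : D ↪ G} {u : D ↪ D′} {v : G ↪ G′} {w : D′ ↪ G′} → IsPushout i u v w →
          (∀ d → d ∈Im onNodes u) → (∀ e → e ∈Im onEdges u) → G ≅ G′
retract {u = u} {v} p surjN surjE = record
  { injection          = v
  ; onNodes-surjective = onto (nodeGluing p) surjN
  ; onEdges-surjective = onto (edgeGluing p) surjE
  }
  where
  onto : {D G D′ G′ : Set} {i : D → G} {u : D → D′} {v : G → G′} {w : D′ → G′} →
         IsGluing i u v w → (∀ d → d ∈Im u) → Surjective _≡_ _≡_ v
  onto {i = i} {v = v} {w = w} q surj y with cover q y
  ... | inj₁ (g , eq) = g , λ { refl → eq }
  ... | inj₂ (d′ , eq) = let (d , u≡) = surj d′
    in i d , λ { refl → trans (commute q d) (trans (cong w u≡) eq) }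

-- Derivations as double pushouts

∈Im∖? : (A B C : FiniteSet) (f : Carrier B → Carrier C) (i : Carrier A → Carrier B) → Decidable (_∈Im f ∖ i)
∈Im∖? A B C f i y = any? B (λ x → ¬? (∈Im? A B i x) ×-dec _≟_ {C} (f x) y)

-- Since `f` is injective, no item in the image of `f ∙ j` is removed, so B maps into D.
remainder⇒pushout : (j : B ↪ X) (f : X ↪ G) (i : D ↪ G) → IsRemainder j f i →
                    Σ[ m ∈ B ↪ D ] IsPushout j m f i
remainder⇒pushout {B = B} {X} {G} {D} j f i rem = m , record
  { nodeGluing = remainder⇒gluing {nodes B} {nodes X} {nodes D} {nodes G} (onNodes-injective i)
      (λ k → sym (proj₂ (nodeIn k))) (IsRemainder.remainingNodes rem)
  ; edgeGluing = remainder⇒gluing {edges B} {edges X} {edges D} {edges G} (onEdges-injective i)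
      (λ k → sym (proj₂ (edgeIn k))) (IsRemainder.remainingEdges rem)
  }
  where
  nodeIn : ∀ k → onNodes (f ∙ j) k ∈Im onNodes i
  nodeIn k = Equivalence.from (IsRemainder.remainingNodes rem _)
    (λ (x , x∉ , eq) → x∉ (k , sym (onNodes-injective f eq)))
  edgeIn : ∀ k → onEdges (f ∙ j) k ∈Im onEdges i
  edgeIn k = Equivalence.from (IsRemainder.remainingEdges rem _)
    (λ (x , x∉ , eq) → x∉ (k , sym (onEdges-injective f eq)))
  m : B ↪ D
  m = lift (f ∙ j) i nodeIn edgeIn

pushout⇒remainder : {j : B ↪ X} {m : B ↪ D} {f : X ↪ G} {i : D ↪ G} → IsPushout j m f i → IsRemainder j f i
pushout⇒remainder {B = B} {X = X} {j = j} p = record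
  { remainingNodes = gluing⇒remainder (∈Im? (nodes B) (nodes X) (onNodes j)) (nodeGluing p)
  ; remainingEdges = gluing⇒remainder (∈Im? (edges B) (edges X) (onEdges j)) (edgeGluing p)
  }

-- The symmetric diagrammatic form of a step, in which squares can be pasted. The dangling condition
-- is implicit in the left square; `toDirectDerivation` recovers it.
record DoublePushout {ℒ : Alphabet} (r : Rule ℒ) {G : Graph ℒ} (g : L r ↪ G) (H : Graph ℒ) : Set₁ where
  field
    context      : Graph ℒ
    interface    : K r ↪ context
    context⊆G    : context ↪ G
    context⊆H    : context ↪ H
    comatch      : R r ↪ H
    leftPushout  : IsPushout (K⊆L r) interface g context⊆G
    rightPushout : IsPushout (K⊆R r) interface comatch context⊆H

open DoublePushout

fromDirectDerivation : {r : Rule ℒ} {g : L r ↪ G} {H : Graph ℒ} → DirectDerivation r g H → DoublePushout r g H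
fromDirectDerivation {r = r} {g} {H} d = record
  { context      = E
  ; interface    = proj₁ left
  ; context⊆G    = D⊆G
  ; context⊆H    = D⊆H
  ; comatch      = DirectDerivation.comatch d
  ; leftPushout  = proj₂ left
  ; rightPushout = record
      { nodeGluing = remainder⇒gluing {nodes (K r)} {nodes (R r)} {nodes E} {nodes H} (onNodes-injective D⊆H)
          (λ k → sym (agreeOnNodes k _ (sym (commute (nodeGluing (proj₂ left)) k))))
          (IsRemainder.remainingNodes addition)
      ; edgeGluing = remainder⇒gluing {edges (K r)} {edges (R r)} {edges E} {edges H} (onEdges-injective D⊆H)
          (λ k → sym (agreeOnEdges k _ (sym (commute (edgeGluing (proj₂ left)) k))))
          (IsRemainder.remainingEdges addition)
      }
  }
  where
  open DirectDerivation d hiding (comatch) renaming (D to E)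
  left : Σ[ m ∈ K r ↪ E ] IsPushout (K⊆L r) m g D⊆G
  left = remainder⇒pushout (K⊆L r) g D⊆G deletion

toDirectDerivation : {r : Rule ℒ} {g : L r ↪ G} {H : Graph ℒ} → DoublePushout r g H → DirectDerivation r g H
toDirectDerivation {G = G} {r} {g} d = record
  { dangling     = λ e e∉ → kept source source-≡ e e∉ , kept target target-≡ e e∉
  ; D            = context d
  ; D⊆G          = context⊆G d
  ; deletion     = deletion
  ; D⊆H          = context⊆H d
  ; comatch      = comatch d
  ; addition     = pushout⇒remainder (rightPushout d)
  ; agreeOnNodes = agree (nodeGluing (leftPushout d)) (nodeGluing (rightPushout d)) (onNodes-injective (context⊆G d))
  ; agreeOnEdges = agree (edgeGluing (leftPushout d)) (edgeGluing (rightPushout d)) (onEdges-injective (context⊆G d))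
  }
  where
  deletion : IsRemainder (K⊆L r) g (context⊆G d)
  deletion = pushout⇒remainder (leftPushout d)
  -- An unmatched edge lies in the context by `cover`; hence so do its endpoints, and nodes of the
  -- context are not deleted.
  kept : (end : (A : Graph _) → Edge A → Node A) →
         (∀ {A B} (h : A ↪ B) e → end B (onEdges h e) ≡ onNodes h (end A e)) →
         ∀ e → ¬ (e ∈Im onEdges g) → ¬ (end G e ∈Im onNodes g ∖ onNodes (K⊆L r))
  kept end end-≡ e e∉ with cover (edgeGluing (leftPushout d)) e
  ... | inj₁ e∈ = contradiction e∈ e∉
  ... | inj₂ (x , eq) = Equivalence.to (IsRemainder.remainingNodes deletion _)
    (end _ x , trans (sym (end-≡ (context⊆G d) x)) (cong (end G) eq))
  agree : {K L R D G H : Set} {j : K → L} {j′ : K → R} {m : K → D} {g : L → G} {h : R → H}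
          {i : D → G} {i′ : D → H} → IsGluing j m g i → IsGluing j′ m h i′ → Injective _≡_ _≡_ i →
          ∀ k x → i x ≡ g (j k) → i′ x ≡ h (j′ k)
  agree {i′ = i′} p q i-injective k x eq =
    trans (cong i′ (i-injective (trans eq (commute p k)))) (sym (commute q k))

derive : (r : Rule ℒ) (g : L r ↪ G) → Dangling r g → ∃ (DoublePushout r g)
derive {G = G} r g dangling = P.object , record
  { context      = graph S
  ; interface    = proj₁ left
  ; context⊆G    = inclusion S
  ; context⊆H    = P.right
  ; comatch      = P.left
  ; leftPushout  = proj₂ left
  ; rightPushout = P.isPushout
  }
  where
  NodeKept : Pred (Node G) 0ℓ
  NodeKept v = ¬ (v ∈Im onNodes g ∖ onNodes (K⊆L r))
  EdgeKept : Pred (Edge G) 0ℓ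
  EdgeKept e = ¬ (e ∈Im onEdges g ∖ onEdges (K⊆L r))
  -- An unmatched edge keeps its endpoints by the dangling condition. A matched edge that is kept
  -- comes from K, so by injectivity of `g` its endpoints come from K too.
  closed : (end : (A : Graph _) → Edge A → Node A) →
           (∀ {A B} (h : A ↪ B) e → end B (onEdges h e) ≡ onNodes h (end A e)) →
           (∀ e → ¬ (e ∈Im onEdges g) → NodeKept (end G e)) → ∀ e → EdgeKept e → NodeKept (end G e)
  closed end end-≡ outside e kept (x , x∉ , x≡) with ∈Im? (edges (L r)) (edges G) (onEdges g) e
  ... | no  e∉ = outside e e∉ (x , x∉ , x≡)
  ... | yes (e′ , e≡) with ∈Im? (edges (K r)) (edges (L r)) (onEdges (K⊆L r)) e′
  ...   | no  e′∉ = kept (e′ , e′∉ , e≡)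
  ...   | yes (k , k≡) = x∉ (end _ k , trans (sym (end-≡ (K⊆L r) k)) (trans (cong (end _) k≡)
    (onNodes-injective g (trans (sym (end-≡ g e′)) (trans (cong (end G) e≡) (sym x≡))))))
  S : Subgraph G NodeKept EdgeKept
  S = subgraphOn G (λ v → ¬? (∈Im∖? (nodes (K r)) (nodes (L r)) (nodes G) (onNodes g) (onNodes (K⊆L r)) v))
                   (λ e → ¬? (∈Im∖? (edges (K r)) (edges (L r)) (edges G) (onEdges g) (onEdges (K⊆L r)) e))
                   (closed source source-≡ (λ e → proj₁ ∘ dangling e))
                   (closed target target-≡ (λ e → proj₂ ∘ dangling e))
  left : Σ[ m ∈ K r ↪ graph S ] IsPushout (K⊆L r) m g (inclusion S)
  left = remainder⇒pushout (K⊆L r) g (inclusion S)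
    (record { remainingNodes = nodeImage S ; remainingEdges = edgeImage S })
  module P = Pushout (pushout (K⊆R r) (proj₁ left))

-- The two contexts are isomorphic, being subgraphs of G with the same image.
result-unique : {r : Rule ℒ} {g g′ : L r ↪ G} {H H′ : Graph ℒ} →
                DoublePushout r g H → DoublePushout r g′ H′ → g ≗ g′ → H ≅ H′
result-unique {G = G} {r = r} {g} {g′} d d′ (gN , gE) = retract
  (Factorization.isPushout (factor {u = φ} (rightPushout d) (rightPushout d′) φ-interface))
  (surjective (onNodes-injective (context⊆G d′)) nodesIn nodesIn′)
  (surjective (onEdges-injective (context⊆G d′)) edgesIn edgesIn′)
  where
  rem = pushout⇒remainder (leftPushout d)
  rem′ = pushout⇒remainder (leftPushout d′)
  within : {K L D D′ G : Set} {j : K → L} {g g′ : L → G} {i : D → G} {i′ : D′ → G} →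
           (∀ v → v ∈Im i ⇔ (¬ (v ∈Im g ∖ j))) → (∀ v → v ∈Im i′ ⇔ (¬ (v ∈Im g′ ∖ j))) →
           (∀ x → g x ≡ g′ x) → ∀ v → i v ∈Im i′
  within p q eqs v = Equivalence.from (q _) (λ (x , x∉ , eq) →
    Equivalence.to (p _) (v , refl) (x , x∉ , trans (eqs x) eq))
  surjective : {D D′ G : Set} {i : D → G} {i′ : D′ → G} → Injective _≡_ _≡_ i′ →
               (p : ∀ v → i v ∈Im i′) → (∀ v → i′ v ∈Im i) → ∀ v → v ∈Im (proj₁ ∘ p)
  surjective i′-injective p q v = proj₁ (q v) , i′-injective (trans (proj₂ (p _)) (proj₂ (q v)))
  nodesIn = within (IsRemainder.remainingNodes rem) (IsRemainder.remainingNodes rem′) gN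
  edgesIn = within (IsRemainder.remainingEdges rem) (IsRemainder.remainingEdges rem′) gE
  nodesIn′ = within (IsRemainder.remainingNodes rem′) (IsRemainder.remainingNodes rem) (sym ∘ gN)
  edgesIn′ = within (IsRemainder.remainingEdges rem′) (IsRemainder.remainingEdges rem) (sym ∘ gE)
  φ : context d ↪ context d′
  φ = lift (context⊆G d) (context⊆G d′) nodesIn edgesIn
  φ-interface : φ ∙ interface d ≗ interface d′
  φ-interface =
    (λ k → onNodes-injective (context⊆G d′) (trans (proj₂ (nodesIn _))
      (trans (sym (commute (nodeGluing (leftPushout d)) k))
        (trans (gN _) (commute (nodeGluing (leftPushout d′)) k))))) ,
    (λ k → onEdges-injective (context⊆G d′) (trans (proj₂ (edgesIn _))
      (trans (sym (commute (edgeGluing (leftPushout d)) k))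
        (trans (gE _) (commute (edgeGluing (leftPushout d′)) k)))))

-- The new context is the old one with C glued on along B. Splitting the pushouts `p₁` and `p₂` at
-- the context by `factor` gives squares that paste onto the two squares of `d`.
extendDerivation : {r : Rule ℒ} {G H B C G⁺ H⁺ : Graph ℒ} {g : L r ↪ G} (d : DoublePushout r g H)
  {c : B ↪ C} (b : B ↪ context d) {b₁ : B ↪ G} {b₂ : B ↪ H}
  {c₁ : C ↪ G⁺} {c₂ : C ↪ H⁺} {i₁ : G ↪ G⁺} {i₂ : H ↪ H⁺} →
  context⊆G d ∙ b ≗ b₁ → IsPushout c b₁ c₁ i₁ →
  context⊆H d ∙ b ≗ b₂ → IsPushout c b₂ c₂ i₂ → DoublePushout r (i₁ ∙ g) H⁺
extendDerivation d {c} b {i₂ = i₂} eq₁ p₁ eq₂ p₂ = record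
  { context      = P.object
  ; interface    = P.right ∙ interface d
  ; context⊆G    = F₁.mediator
  ; context⊆H    = F₂.mediator
  ; comatch      = i₂ ∙ comatch d
  ; leftPushout  = paste (leftPushout d) (swap F₁.isPushout)
  ; rightPushout = paste (rightPushout d) (swap F₂.isPushout)
  }
  where
  module P = Pushout (pushout c b)
  module F₁ = Factorization (factor {u = context⊆G d} P.isPushout p₁ eq₁)
  module F₂ = Factorization (factor {u = context⊆H d} P.isPushout p₂ eq₂)

-- Parallel independence

-- The gluing of L and D is pulled back along `i′`. All of L already lies in E, so only D shrinks,
-- to its intersection S with E.
restrictGluing : {K L D S E G : Set} {j : K → L} {m : K → D} {n : K → S} {g : L → G} {l : L → E}
                 {i : D → G} {i′ : E → G} {p : S → E} {p′ : S → D} →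
                 IsGluing j m g i → Injective _≡_ _≡_ i′ → Injective _≡_ _≡_ p′ →
                 (∀ x → i′ (l x) ≡ g x) → (∀ k → p′ (n k) ≡ m k) → (∀ s → i′ (p s) ≡ i (p′ s)) →
                 (∀ {x d} → i′ x ≡ i d → ∃[ s ] (p s ≡ x × p′ s ≡ d)) → IsGluing j n l p
restrictGluing {E = E} {i = i} {i′} {p = p} q i′-injective p′-injective l≡ n≡ p≡ meets = record
  { commute = λ k → i′-injective (trans (l≡ _) (trans (commute q k)
      (trans (cong i (sym (n≡ k))) (sym (p≡ _)))))
  ; meet    = λ eq → let (k , j≡ , m≡) = meet q (trans (sym (l≡ _)) (trans (cong i′ eq) (p≡ _)))
                     in k , j≡ , p′-injective (trans (n≡ k) m≡)
  ; cover   = covered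
  }
  where
  covered : ∀ x → x ∈Im _ ⊎ x ∈Im p
  covered x with cover q (i′ x)
  ... | inj₁ (y , g≡) = inj₁ (y , i′-injective (trans (l≡ y) g≡))
  ... | inj₂ (d , i≡) = let (s , p≡x , _) = meets (sym i≡) in inj₂ (s , p≡x)

-- The intersection S of the two contexts, given by its pullback property. The data are symmetric in
-- the two steps, so that only one of the two residual steps has to be constructed.
record Overlap {r₁ r₂ : Rule ℒ} {G H₁ H₂ : Graph ℒ} {g₁ : L r₁ ↪ G} {g₂ : L r₂ ↪ G}
               (d₁ : DoublePushout r₁ g₁ H₁) (d₂ : DoublePushout r₂ g₂ H₂) : Set₁ where
  field
    object      : Graph ℒ
    π₁          : object ↪ context d₁
    π₂          : object ↪ context d₂
    square      : context⊆G d₁ ∙ π₁ ≗ context⊆G d₂ ∙ π₂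
    nodeMeet    : ∀ {x y} → onNodes (context⊆G d₁) x ≡ onNodes (context⊆G d₂) y →
                  ∃[ s ] (onNodes π₁ s ≡ x × onNodes π₂ s ≡ y)
    edgeMeet    : ∀ {x y} → onEdges (context⊆G d₁) x ≡ onEdges (context⊆G d₂) y →
                  ∃[ s ] (onEdges π₁ s ≡ x × onEdges π₂ s ≡ y)
    interface₁  : K r₁ ↪ object
    interface₂  : K r₂ ↪ object
    interface₁≗ : π₁ ∙ interface₁ ≗ interface d₁
    interface₂≗ : π₂ ∙ interface₂ ≗ interface d₂
    match₁      : L r₁ ↪ context d₂
    match₂      : L r₂ ↪ context d₁
    match₁≗     : context⊆G d₂ ∙ match₁ ≗ g₁
    match₂≗     : context⊆G d₁ ∙ match₂ ≗ g₂

swapOverlap : {r₁ r₂ : Rule ℒ} {G H₁ H₂ : Graph ℒ} {g₁ : L r₁ ↪ G} {g₂ : L r₂ ↪ G}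
              {d₁ : DoublePushout r₁ g₁ H₁} {d₂ : DoublePushout r₂ g₂ H₂} → Overlap d₁ d₂ → Overlap d₂ d₁
swapOverlap o = record
  { object      = object
  ; π₁          = π₂
  ; π₂          = π₁
  ; square      = sym ∘ proj₁ square , sym ∘ proj₂ square
  ; nodeMeet    = λ eq → let (s , a , b) = nodeMeet (sym eq) in s , b , a
  ; edgeMeet    = λ eq → let (s , a , b) = edgeMeet (sym eq) in s , b , a
  ; interface₁  = interface₂
  ; interface₂  = interface₁
  ; interface₁≗ = interface₂≗
  ; interface₂≗ = interface₁≗
  ; match₁      = match₂
  ; match₂      = match₁
  ; match₁≗     = match₂≗
  ; match₂≗     = match₁≗
  }
  where open Overlap o

-- This is `ParallellyIndependent` stated for the matches alone, so that it applies to double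
-- pushouts.
Independent : {r₁ r₂ : Rule ℒ} {G : Graph ℒ} → L r₁ ↪ G → L r₂ ↪ G → Set
Independent {r₁ = r₁} {r₂} g₁ g₂ =
  (∀ v → v ∈Im onNodes g₁ → v ∈Im onNodes g₂ →
    v ∈Im (onNodes g₁ ∘ onNodes (K⊆L r₁)) × v ∈Im (onNodes g₂ ∘ onNodes (K⊆L r₂))) ×
  (∀ e → e ∈Im onEdges g₁ → e ∈Im onEdges g₂ →
    e ∈Im (onEdges g₁ ∘ onEdges (K⊆L r₁)) × e ∈Im (onEdges g₂ ∘ onEdges (K⊆L r₂)))

-- An item matched by both rules comes from both interfaces, so neither step deletes anything that
-- the other one matches. Each match therefore lands in the other context, and each interface lands
-- in both.
contextOverlap : {r₁ r₂ : Rule ℒ} {G H₁ H₂ : Graph ℒ} {g₁ : L r₁ ↪ G} {g₂ : L r₂ ↪ G}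
                 (d₁ : DoublePushout r₁ g₁ H₁) (d₂ : DoublePushout r₂ g₂ H₂) →
                 Independent {r₁ = r₁} {r₂} g₁ g₂ → Overlap d₁ d₂
contextOverlap {ℒ} {r₁} {r₂} {G} {g₁ = g₁} {g₂} d₁ d₂ (indN , indE) = record
  { object      = graph S
  ; π₁          = lift (inclusion S) (context⊆G d₁) (proj₁ ∘ inN) (proj₁ ∘ inE)
  ; π₂          = lift (inclusion S) (context⊆G d₂) (proj₂ ∘ inN) (proj₂ ∘ inE)
  ; square      = (λ s → trans (proj₂ (proj₁ (inN s))) (sym (proj₂ (proj₂ (inN s))))) ,
                  (λ s → trans (proj₂ (proj₁ (inE s))) (sym (proj₂ (proj₂ (inE s)))))
  ; nodeMeet    = meets (nodeImage S) inN (onNodes-injective (context⊆G d₁)) (onNodes-injective (context⊆G d₂))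
  ; edgeMeet    = meets (edgeImage S) inE (onEdges-injective (context⊆G d₁)) (onEdges-injective (context⊆G d₂))
  ; interface₁  = lift (context⊆G d₁ ∙ interface d₁) (inclusion S) onN₁ onE₁
  ; interface₂  = lift (context⊆G d₂ ∙ interface d₂) (inclusion S) onN₂ onE₂
  ; interface₁≗ = (λ k → onNodes-injective (context⊆G d₁) (trans (proj₂ (proj₁ (inN _))) (proj₂ (onN₁ k)))) ,
                  (λ k → onEdges-injective (context⊆G d₁) (trans (proj₂ (proj₁ (inE _))) (proj₂ (onE₁ k))))
  ; interface₂≗ = (λ k → onNodes-injective (context⊆G d₂) (trans (proj₂ (proj₂ (inN _))) (proj₂ (onN₂ k)))) ,
                  (λ k → onEdges-injective (context⊆G d₂) (trans (proj₂ (proj₂ (inE _))) (proj₂ (onE₂ k))))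
  ; match₁      = lift g₁ (context⊆G d₂) keptN₁ keptE₁
  ; match₂      = lift g₂ (context⊆G d₁) keptN₂ keptE₂
  ; match₁≗     = proj₂ ∘ keptN₁ , proj₂ ∘ keptE₁
  ; match₂≗     = proj₂ ∘ keptN₂ , proj₂ ∘ keptE₂
  }
  where
  S : Subgraph G (λ v → v ∈Im onNodes (context⊆G d₁) × v ∈Im onNodes (context⊆G d₂))
                 (λ e → e ∈Im onEdges (context⊆G d₁) × e ∈Im onEdges (context⊆G d₂))
  S = subgraphOn G
    (λ v → ∈Im? (nodes (context d₁)) (nodes G) (onNodes (context⊆G d₁)) v ×-dec
           ∈Im? (nodes (context d₂)) (nodes G) (onNodes (context⊆G d₂)) v)
    (λ e → ∈Im? (edges (context d₁)) (edges G) (onEdges (context⊆G d₁)) e ×-dec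
           ∈Im? (edges (context d₂)) (edges G) (onEdges (context⊆G d₂)) e)
    (λ _ (e₁ , e₂) → sourceIn (context⊆G d₁) e₁ , sourceIn (context⊆G d₂) e₂)
    (λ _ (e₁ , e₂) → targetIn (context⊆G d₁) e₁ , targetIn (context⊆G d₂) e₂)
  inN : ∀ s → onNodes (inclusion S) s ∈Im onNodes (context⊆G d₁) × onNodes (inclusion S) s ∈Im onNodes (context⊆G d₂)
  inN s = Equivalence.to (nodeImage S _) (s , refl)
  inE : ∀ s → onEdges (inclusion S) s ∈Im onEdges (context⊆G d₁) × onEdges (inclusion S) s ∈Im onEdges (context⊆G d₂)
  inE s = Equivalence.to (edgeImage S _) (s , refl)
  meets : {S D D′ G : Set} {ι : S → G} {i : D → G} {i′ : D′ → G} →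
          (∀ v → v ∈Im ι ⇔ (v ∈Im i × v ∈Im i′)) → (ins : ∀ s → ι s ∈Im i × ι s ∈Im i′) →
          Injective _≡_ _≡_ i → Injective _≡_ _≡_ i′ →
          ∀ {x y} → i x ≡ i′ y → ∃[ s ] (proj₁ (proj₁ (ins s)) ≡ x × proj₁ (proj₂ (ins s)) ≡ y)
  meets image ins i-injective i′-injective {x} {y} eq =
    let (s , ι≡) = Equivalence.from (image _) ((x , refl) , (y , sym eq))
    in s , i-injective (trans (proj₂ (proj₁ (ins s))) ι≡) ,
           i′-injective (trans (proj₂ (proj₂ (ins s))) (trans ι≡ eq))
  kept : {K L D G : Set} {j : K → L} {g : L → G} {i : D → G} → Injective _≡_ _≡_ g →
         (∀ v → v ∈Im i ⇔ (¬ (v ∈Im g ∖ j))) → ∀ v → (v ∈Im g → v ∈Im (g ∘ j)) → v ∈Im i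
  kept g-injective remaining v ind = Equivalence.from (remaining v)
    (λ (x , x∉ , eq) → let (k , gj≡) = ind (x , eq) in x∉ (k , g-injective (trans gj≡ (sym eq))))
  rem₁ : IsRemainder (K⊆L r₁) g₁ (context⊆G d₁)
  rem₁ = pushout⇒remainder (leftPushout d₁)
  rem₂ : IsRemainder (K⊆L r₂) g₂ (context⊆G d₂)
  rem₂ = pushout⇒remainder (leftPushout d₂)
  keptN₁ : ∀ x → onNodes g₁ x ∈Im onNodes (context⊆G d₂)
  keptN₁ x = kept (onNodes-injective g₂) (IsRemainder.remainingNodes rem₂) _ (λ v∈ → proj₂ (indN _ (x , refl) v∈))
  keptN₂ : ∀ x → onNodes g₂ x ∈Im onNodes (context⊆G d₁)
  keptN₂ x = kept (onNodes-injective g₁) (IsRemainder.remainingNodes rem₁) _ (λ v∈ → proj₁ (indN _ v∈ (x , refl)))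
  keptE₁ : ∀ x → onEdges g₁ x ∈Im onEdges (context⊆G d₂)
  keptE₁ x = kept (onEdges-injective g₂) (IsRemainder.remainingEdges rem₂) _ (λ e∈ → proj₂ (indE _ (x , refl) e∈))
  keptE₂ : ∀ x → onEdges g₂ x ∈Im onEdges (context⊆G d₁)
  keptE₂ x = kept (onEdges-injective g₁) (IsRemainder.remainingEdges rem₁) _ (λ e∈ → proj₁ (indE _ e∈ (x , refl)))
  onN₁ : ∀ k → onNodes (context⊆G d₁ ∙ interface d₁) k ∈Im onNodes (inclusion S)
  onN₁ k = Equivalence.from (nodeImage S _)
    ((_ , refl) , subst (_∈Im onNodes (context⊆G d₂)) (commute (nodeGluing (leftPushout d₁)) k) (keptN₁ _))
  onN₂ : ∀ k → onNodes (context⊆G d₂ ∙ interface d₂) k ∈Im onNodes (inclusion S)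
  onN₂ k = Equivalence.from (nodeImage S _)
    (subst (_∈Im onNodes (context⊆G d₁)) (commute (nodeGluing (leftPushout d₂)) k) (keptN₂ _) , (_ , refl))
  onE₁ : ∀ k → onEdges (context⊆G d₁ ∙ interface d₁) k ∈Im onEdges (inclusion S)
  onE₁ k = Equivalence.from (edgeImage S _)
    ((_ , refl) , subst (_∈Im onEdges (context⊆G d₂)) (commute (edgeGluing (leftPushout d₁)) k) (keptE₁ _))
  onE₂ : ∀ k → onEdges (context⊆G d₂ ∙ interface d₂) k ∈Im onEdges (inclusion S)
  onE₂ k = Equivalence.from (edgeImage S _)
    (subst (_∈Im onEdges (context⊆G d₁)) (commute (edgeGluing (leftPushout d₂)) k) (keptE₂ _) , (_ , refl))

-- H₁ is obtained from R₁ +_K₁ S, with S the overlap, by adding L₂ along K₂;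
-- replacing L₂ by R₂ yields M.
residual : {r₁ r₂ : Rule ℒ} {G H₁ H₂ M : Graph ℒ} {g₁ : L r₁ ↪ G} {g₂ : L r₂ ↪ G}
           {d₁ : DoublePushout r₁ g₁ H₁} {d₂ : DoublePushout r₂ g₂ H₂} (o : Overlap d₁ d₂)
           (P₁ : Pushout (K⊆R r₁) (Overlap.interface₁ o)) (P₂ : Pushout (K⊆R r₂) (Overlap.interface₂ o))
           {x : Pushout.object P₁ ↪ M} {y : Pushout.object P₂ ↪ M} →
           IsPushout (Pushout.right P₁) (Pushout.right P₂) x y →
           DoublePushout r₂ (context⊆H d₁ ∙ Overlap.match₂ o) M
residual {d₁ = d₁} {d₂} o P₁ P₂ {x} {y} q = record
  { context      = P₁.object
  ; interface    = P₁.right ∙ O.interface₂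
  ; context⊆G    = F.mediator
  ; context⊆H    = x
  ; comatch      = y ∙ P₂.left
  ; leftPushout  = paste restricted (swap F.isPushout)
  ; rightPushout = paste P₂.isPushout (swap q)
  }
  where
  module O = Overlap o
  module P₁ = Pushout P₁
  module P₂ = Pushout P₂
  module F = Factorization (factor {u = O.π₁} P₁.isPushout (rightPushout d₁) O.interface₁≗)
  restricted : IsPushout _ O.interface₂ O.match₂ O.π₁
  restricted = record
    { nodeGluing = restrictGluing (nodeGluing (leftPushout d₂)) (onNodes-injective (context⊆G d₁))
        (onNodes-injective O.π₂) (proj₁ O.match₂≗) (proj₁ O.interface₂≗) (proj₁ O.square) O.nodeMeet
    ; edgeGluing = restrictGluing (edgeGluing (leftPushout d₂)) (onEdges-injective (context⊆G d₁))
        (onEdges-injective O.π₂) (proj₂ O.match₂≗) (proj₂ O.interface₂≗) (proj₂ O.square) O.edgeMeet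
    }

-- Extension of derivations

congGluing : {K X D G : Set} {j : K → X} {m m′ : K → D} {f : X → G} {i : D → G} →
             IsGluing j m f i → (∀ k → m k ≡ m′ k) → IsGluing j m′ f i
congGluing {i = i} p m≡ = record
  { commute = λ k → trans (commute p k) (cong i (m≡ k))
  ; meet    = λ eq → let (k , j≡ , eq′) = meet p eq in k , j≡ , trans (sym (m≡ k)) eq′
  ; cover   = cover p
  }

transportGluing : {K X D G G′ : Set} {j : K → X} {m : K → D} {f : X → G} {i : D → G} {φ : G → G′} →
                  IsGluing j m f i → Injective _≡_ _≡_ φ → Surjective _≡_ _≡_ φ →
                  IsGluing j m (φ ∘ f) (φ ∘ i)
transportGluing {G′ = G′} {f = f} {i} {φ} p φ-injective φ-surjective = record
  { commute = λ k → cong φ (commute p k)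
  ; meet    = λ eq → meet p (φ-injective eq)
  ; cover   = covered
  }
  where
  covered : ∀ y → y ∈Im (φ ∘ f) ⊎ y ∈Im (φ ∘ i)
  covered y with φ-surjective y
  ... | g , φ≡ with cover p g
  ...   | inj₁ (x , eq) = inj₁ (x , φ≡ eq)
  ...   | inj₂ (d , eq) = inj₂ (d , φ≡ eq)

transport : {j : B ↪ X} {m : B ↪ D} {f : X ↪ G} {i : D ↪ G} (φ : G ≅ G′) → IsPushout j m f i →
            IsPushout j m (injection φ ∙ f) (injection φ ∙ i)
transport φ p = record
  { nodeGluing = transportGluing (nodeGluing p) (onNodes-injective (injection φ)) (onNodes-surjective φ)
  ; edgeGluing = transportGluing (edgeGluing p) (onEdges-injective (injection φ)) (onEdges-surjective φ)
  }

module _ {T : GTSystem} where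

  -- Tracks speak of nodes only, so the position of B in the result is prescribed by a function `w`
  -- on nodes; B will have no edges.
  record Extension {B C G H G⁺ : Graph (alphabet T)} (c : B ↪ C) (d : Step T G H) (i : G ↪ G⁺)
                   (w : Node B → Node H) : Set₁ where
    field
      boundary   : B ↪ H
      boundary≗  : ∀ v → onNodes boundary v ≡ w v
      pushoutOfH : Pushout c boundary
      extended   : DoublePushout (Step.usedRule d) (i ∙ Step.match d) (Pushout.object pushoutOfH)

  -- Every node of B has a track, so it lies in the context of `d`. As B is discrete, all of B then
  -- factors through that context, which is what `extendDerivation` asks for.
  extendStep : {B C G H G⁺ : Graph (alphabet T)} → ¬ Edge B → {c : B ↪ C} {b : B ↪ G} {c⁺ : C ↪ G⁺} {i : G ↪ G⁺} →
               IsPushout c b c⁺ i → (d : Step T G H) {w : Node B → Node H} →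
               (∀ v → StepTrack d (onNodes b v) (w v)) → Extension c d i w
  extendStep {B} noEdges {c} {b} p d tracks = record
    { boundary   = D⊆H ∙ bD
    ; boundary≗  = proj₂ ∘ proj₂ ∘ tracks
    ; pushoutOfH = pushout c (D⊆H ∙ bD)
    ; extended   = extendDerivation (fromDirectDerivation (Step.derivation d)) bD
        (proj₁ ∘ proj₂ ∘ tracks , ⊥-elim ∘ noEdges) p ((λ _ → refl) , (λ _ → refl))
        (Pushout.isPushout (pushout c (D⊆H ∙ bD)))
    }
    where
    open Step d using (D⊆G; D⊆H)
    bD : B ↪ Step.D d
    bD = lift b D⊆G (λ v → proj₁ (tracks v) , proj₁ (proj₂ (tracks v))) (⊥-elim ∘ noEdges)

  track-iso : {G H : Graph (alphabet T)} {φ : G ≅ H} {v : Node G} {w : Node H} →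
              Track {T} (iso φ) v w → onNodes (injection φ) v ≡ w
  track-iso (iso φ v) = refl

  track-uncons : {G H M : Graph (alphabet T)} {d : Step T G H} {ds : Derivation T H M} {u : Node G} {w : Node M} →
                 Track (d ◅ ds) u w → ∃[ v ] (StepTrack d u v × Track ds v w)
  track-uncons (t ◅ ts) = _ , t , ts

  -- The end graph may be any pushout of C and M along the boundary. This freedom lets two extended
  -- derivations end in the very same graph.
  record Extensions {B C : Graph (alphabet T)} (c : B ↪ C) (M : Graph (alphabet T)) (w : Node B → Node M)
                    (H⁺ : Graph (alphabet T)) : Set₁ where
    field
      boundary  : B ↪ M
      boundary≗ : ∀ v → onNodes boundary v ≡ w v
      extended  : ∀ {M⁺} {c⁺ : C ↪ M⁺} {i : M ↪ M⁺} → IsPushout c boundary c⁺ i → Derivation T H⁺ M⁺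

  -- Induction on the derivation, gluing C to each intermediate graph along the tracked copy of B.
  -- In length 0 the isomorphism extends over the gluing by `retract`.
  extend : {B C G M G⁺ : Graph (alphabet T)} → ¬ Edge B → {c : B ↪ C} {b : B ↪ G} {c⁺ : C ↪ G⁺} {i : G ↪ G⁺} →
           IsPushout c b c⁺ i → (ds : Derivation T G M) {w : Node B → Node M} →
           (∀ v → Track ds (onNodes b v) (w v)) → Extensions c M w G⁺
  extend noEdges {b = b} p (iso φ) tracks = record
    { boundary  = injection φ ∙ b
    ; boundary≗ = track-iso {φ = φ} ∘ tracks
    ; extended  = λ q → iso (retract
        (Factorization.isPushout (factor {u = injection φ} p q ((λ _ → refl) , (λ _ → refl))))
        (λ v → let (x , eq) = onNodes-surjective φ v in x , eq refl)
        (λ e → let (x , eq) = onEdges-surjective φ e in x , eq refl))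
    }
  extend noEdges {c} {i = i} p (d ◅ ds) tracks = record
    { boundary  = Rest.boundary
    ; boundary≗ = Rest.boundary≗
    ; extended  = λ q → record { index = Step.index d ; match = i ∙ Step.match d
                               ; derivation = toDirectDerivation First.extended } ◅ Rest.extended q
    }
    where
    module First = Extension (extendStep noEdges p d (proj₁ ∘ proj₂ ∘ track-uncons ∘ tracks))
    module Rest = Extensions (extend noEdges (Pushout.isPushout First.pushoutOfH) ds
      (λ v → subst (λ x → Track ds x _) (sym (First.boundary≗ v)) (proj₂ (proj₂ (track-uncons (tracks v))))))

  -- Here the first step out of `G⁺` is given and ends in `H⁺`. By `result-unique` the extension of
  -- `d` has an isomorphic result; its pushout is transported to `H⁺`, where `ds` is extended.
  extendAlong : {B C G H M G⁺ H⁺ : Graph (alphabet T)} → ¬ Edge B →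
                {c : B ↪ C} {b : B ↪ G} {c⁺ : C ↪ G⁺} {i : G ↪ G⁺} → IsPushout c b c⁺ i →
                (d : Step T G H) {g : L (Step.usedRule d) ↪ G⁺} → i ∙ Step.match d ≗ g →
                DoublePushout (Step.usedRule d) g H⁺ →
                (ds : Derivation T H M) {w : Node B → Node M} →
                (∀ v → Track (d ◅ ds) (onNodes b v) (w v)) → Extensions c M w H⁺
  extendAlong noEdges p d match≗ d⁺ ds tracks = extend noEdges
    (transport (result-unique First.extended d⁺ match≗) (Pushout.isPushout First.pushoutOfH)) ds
    (λ v → subst (λ x → Track ds x _) (sym (First.boundary≗ v)) (proj₂ (proj₂ (track-uncons (tracks v)))))
    where
    module First = Extension (extendStep noEdges p d (proj₁ ∘ proj₂ ∘ track-uncons ∘ tracks))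

-- Restriction to the critical part

record Complement {X G : Graph ℒ} (ι : X ↪ G) (P : Pred (Node X) 0ℓ) : Set₁ where
  field
    boundary    : Subgraph X P (λ _ → ⊥)
    rest        : Graph ℒ
    attachment  : graph boundary ↪ rest
    rest⊆G      : rest ↪ G
    isPushout   : IsPushout attachment (inclusion boundary) rest⊆G ι

  noEdges : ¬ Edge (graph boundary)
  noEdges e = Equivalence.to (edgeImage boundary _) (e , refl)

-- C consists of the items outside the image of `ι` and the nodes of X satisfying `P`. It is a graph
-- because an edge outside that image can touch it only in such nodes.
complement : (ι : X ↪ G) {P : Pred (Node X) 0ℓ} → Decidable P →
             (∀ e → ¬ (e ∈Im onEdges ι) → (∀ x → onNodes ι x ≡ source G e → P x) ×
                                          (∀ x → onNodes ι x ≡ target G e → P x)) →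
             Complement ι P
complement {X = X} {G = G} ι {P} P? attached = record
  { boundary   = S
  ; rest       = graph C
  ; attachment = lift (ι ∙ inclusion S) (inclusion C)
      (λ v → Equivalence.from (nodeImage C _) (inj₂ (v , refl)))
      (λ e → Equivalence.from (edgeImage C _) (inj₂ (e , refl)))
  ; rest⊆G     = inclusion C
  ; isPushout  = record
      { nodeGluing = glue {nodes X} {nodes G} (onNodes-injective ι) (onNodes-injective (inclusion C)) (nodeImage C)
      ; edgeGluing = glue {edges X} {edges G} (onEdges-injective ι) (onEdges-injective (inclusion C)) (edgeImage C)
      }
  }
  where
  S : Subgraph X P (λ _ → ⊥)
  S = subgraphOn X P? (λ _ → no λ ()) (λ _ ()) (λ _ ())
  InRest : {B X G : Set} (b : B → X) (ι : X → G) → Pred G 0ℓ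
  InRest b ι y = ¬ (y ∈Im ι) ⊎ y ∈Im (ι ∘ b)
  inRest? : (B X G : FiniteSet) (b : Carrier B → Carrier X) (ι : Carrier X → Carrier G) → Decidable (InRest b ι)
  inRest? B X G b ι y = ¬? (∈Im? X G ι y) ⊎-dec ∈Im? B G (ι ∘ b) y
  closed : (end : (A : Graph _) → Edge A → Node A) →
           (∀ e → ¬ (e ∈Im onEdges ι) → ∀ x → onNodes ι x ≡ end G e → P x) →
           ∀ e → InRest (onEdges (inclusion S)) (onEdges ι) e → InRest (onNodes (inclusion S)) (onNodes ι) (end G e)
  closed end at e (inj₂ (s , _)) = contradiction (s , refl) (Equivalence.to (edgeImage S _))
  closed end at e (inj₁ e∉) with ∈Im? (nodes X) (nodes G) (onNodes ι) (end G e)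
  ... | no  v∉ = inj₁ v∉
  ... | yes (x , ι≡) = let (s , s≡) = Equivalence.from (nodeImage S x) (at e e∉ x ι≡)
    in inj₂ (s , trans (cong (onNodes ι) s≡) ι≡)
  C : Subgraph G (InRest (onNodes (inclusion S)) (onNodes ι)) (InRest (onEdges (inclusion S)) (onEdges ι))
  C = subgraphOn G (inRest? (nodes (graph S)) (nodes X) (nodes G) _ _)
                   (inRest? (edges (graph S)) (edges X) (edges G) _ _)
                   (closed source (λ e → proj₁ ∘ attached e)) (closed target (λ e → proj₂ ∘ attached e))
  -- The first leg is spelled out so that it is definitionally the map that `lift` produces for
  -- `attachment`.
  glue : {X G : FiniteSet} {B C : Set} {b : B → Carrier X} {ι : Carrier X → Carrier G} {κ : C → Carrier G} →
         Injective _≡_ _≡_ ι → Injective _≡_ _≡_ κ → (image : ∀ y → y ∈Im κ ⇔ InRest b ι y) →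
         IsGluing (λ v → proj₁ (Equivalence.from (image (ι (b v))) (inj₂ (v , refl)))) b κ ι
  glue {X} {G} {b = b} {ι} {κ} ι-injective κ-injective image = record
    { commute = λ v → proj₂ (Equivalence.from (image (ι (b v))) (inj₂ (v , refl)))
    ; meet    = met
    ; cover   = covered
    }
    where
    met : ∀ {x d} → κ x ≡ ι d →
          ∃[ v ] (proj₁ (Equivalence.from (image (ι (b v))) (inj₂ (v , refl))) ≡ x × b v ≡ d)
    met {x} {d} eq with Equivalence.to (image (κ x)) (x , refl)
    ... | inj₁ ∉ι = contradiction (d , sym eq) ∉ι
    ... | inj₂ (v , ιb≡) =
      v , κ-injective (trans (proj₂ (Equivalence.from (image (ι (b v))) (inj₂ (v , refl)))) ιb≡) ,
      ι-injective (trans ιb≡ eq)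
    covered : ∀ y → y ∈Im κ ⊎ y ∈Im ι
    covered y with ∈Im? X G ι y
    ... | yes y∈ = inj₂ y∈
    ... | no  y∉ = inj₁ (Equivalence.from (image y) (inj₁ y∉))

∖-image : {K L X G : Set} {j : K → L} {g : L → G} {g′ : L → X} {ι : X → G} → (∀ x → ι (g′ x) ≡ g x) →
          ∀ {x y} → ι x ≡ y → x ∈Im g′ ∖ j → y ∈Im g ∖ j
∖-image {ι = ι} ≡g eq (z , z∉ , g′≡) = z , z∉ , trans (sym (≡g z)) (trans (cong ι g′≡) eq)

-- Along `ι` an unmatched edge of X stays unmatched, and a deleted endpoint stays deleted, so a
-- violation in X would be one in G.
danglingRestrict : {r : Rule ℒ} {g : L r ↪ G} {g′ : L r ↪ X} (ι : X ↪ G) → ι ∙ g′ ≗ g →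
                   Dangling r g → Dangling r g′
danglingRestrict {r = r} {g} {g′} ι (≗N , ≗E) dangling e e∉ =
  proj₁ (dangling (onEdges ι e) outside) ∘ ∖-image {j = onNodes (K⊆L r)} {ι = onNodes ι} ≗N (sym (source-≡ ι e)) ,
  proj₂ (dangling (onEdges ι e) outside) ∘ ∖-image {j = onNodes (K⊆L r)} {ι = onNodes ι} ≗N (sym (target-≡ ι e))
  where
  outside : ¬ (onEdges ι e ∈Im onEdges g)
  outside (x , eq) = e∉ (x , onEdges-injective ι (trans (≗E x) eq))

-- Joining the results of two steps

module _ {T : GTSystem} {G H₁ H₂ : Graph (alphabet T)} (d₁ : Step T G H₁) (d₂ : Step T G H₂) where

  private
    r₁ = Step.usedRule d₁
    r₂ = Step.usedRule d₂
    g₁ = Step.match d₁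
    g₂ = Step.match d₂

  parallellyIndependent? : Dec (ParallellyIndependent d₁ d₂)
  parallellyIndependent? =
    agree? (nodes (K r₁)) (nodes (L r₁)) (nodes (K r₂)) (nodes (L r₂)) (nodes G) _ _ _ _ ×-dec
    agree? (edges (K r₁)) (edges (L r₁)) (edges (K r₂)) (edges (L r₂)) (edges G) _ _ _ _
    where
    agree? : (K₁ L₁ K₂ L₂ G : FiniteSet) (j₁ : Carrier K₁ → Carrier L₁) (f₁ : Carrier L₁ → Carrier G)
             (j₂ : Carrier K₂ → Carrier L₂) (f₂ : Carrier L₂ → Carrier G) →
             Dec (∀ v → v ∈Im f₁ → v ∈Im f₂ → v ∈Im (f₁ ∘ j₁) × v ∈Im (f₂ ∘ j₂))
    agree? K₁ L₁ K₂ L₂ G j₁ f₁ j₂ f₂ = all? G (λ v → ∈Im? L₁ G f₁ v →-dec (∈Im? L₂ G f₂ v →-dec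
      (∈Im? K₁ G (f₁ ∘ j₁) v ×-dec ∈Im? K₂ G (f₂ ∘ j₂) v)))

  SameMatch : Set
  SameMatch = Σ[ eq ∈ Step.index d₁ ≡ Step.index d₂ ] subst (λ i → L (rule T i) ↪ G) eq g₁ ≗ g₂

  sameMatch? : Dec SameMatch
  sameMatch? = decide g₁ g₂
    where
    -- The indices are generalised to variables so that their equality can be matched with `refl`.
    decide : ∀ {i₁ i₂} (f₁ : L (rule T i₁) ↪ G) (f₂ : L (rule T i₂) ↪ G) →
             Dec (Σ[ eq ∈ i₁ ≡ i₂ ] subst (λ i → L (rule T i) ↪ G) eq f₁ ≗ f₂)
    decide {i₁} {i₂} f₁ f₂ with i₁ Fin.≟ i₂
    ... | no  ≢    = no (≢ ∘ proj₁)
    ... | yes refl = map′ (refl ,_) (λ { (refl , same) → same })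
      (all? (nodes (L (rule T i₁))) (λ v → _≟_ {nodes G} (onNodes f₁ v) (onNodes f₂ v)) ×-dec
       all? (edges (L (rule T i₁))) (λ e → _≟_ {edges G} (onEdges f₁ e) (onEdges f₂ e)))

  join-same : SameMatch → Joinable T H₁ H₂
  join-same (eq , same) =
    H₂ , iso (unique eq same (fromDirectDerivation (Step.derivation d₁)) (fromDirectDerivation (Step.derivation d₂))) ,
    iso ≅-refl
    where
    unique : ∀ {i₁ i₂} {f₁ : L (rule T i₁) ↪ G} {f₂ : L (rule T i₂) ↪ G} (eq : i₁ ≡ i₂) →
             subst (λ i → L (rule T i) ↪ G) eq f₁ ≗ f₂ →
             DoublePushout (rule T i₁) f₁ H₁ → DoublePushout (rule T i₂) f₂ H₂ → H₁ ≅ H₂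
    unique refl same p q = result-unique p q same

  -- Both right-hand sides are glued to the overlap. The result is reached from `H₁` by the second
  -- rule and, by symmetry, from `H₂` by the first.
  join-independent : ParallellyIndependent d₁ d₂ → Joinable T H₁ H₂
  join-independent ind = Q.object ,
    toStep (residual o P₁ P₂ Q.isPushout) ◅ iso ≅-refl ,
    toStep (residual (swapOverlap o) P₂ P₁ (swap Q.isPushout)) ◅ iso ≅-refl
    where
    toStep : ∀ {i G H} {g : L (rule T i) ↪ G} → DoublePushout (rule T i) g H → Step T G H
    toStep d = record { derivation = toDirectDerivation d }
    o = contextOverlap (fromDirectDerivation (Step.derivation d₁)) (fromDirectDerivation (Step.derivation d₂)) ind
    P₁ = pushout (K⊆R r₁) (Overlap.interface₁ o)
    P₂ = pushout (K⊆R r₂) (Overlap.interface₂ o)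
    module Q = Pushout (pushout (Pushout.right P₁) (Pushout.right P₂))

  -- Strong joinability is assumed only over graphs embedded in G, which is as much as the
  -- non-garbage condition provides.
  join-conflict : ¬ SameMatch → ¬ ParallellyIndependent d₁ d₂ →
    (∀ {X H₁ H₂} (d₁ : Step T X H₁) (d₂ : Step T X H₂) → X ↪ G → CriticalPair d₁ d₂ → StronglyJoinable d₁ d₂) →
    Joinable T H₁ H₂
  join-conflict ¬same ¬independent joins = M⁺.object , E₁.extended M⁺.isPushout , E₂.extended boundary₂
    where
    U : Subgraph G (λ v → v ∈Im onNodes g₁ ⊎ v ∈Im onNodes g₂) (λ e → e ∈Im onEdges g₁ ⊎ e ∈Im onEdges g₂)
    U = subgraphOn G
      (λ v → ∈Im? (nodes (L r₁)) (nodes G) (onNodes g₁) v ⊎-dec ∈Im? (nodes (L r₂)) (nodes G) (onNodes g₂) v)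
      (λ e → ∈Im? (edges (L r₁)) (edges G) (onEdges g₁) e ⊎-dec ∈Im? (edges (L r₂)) (edges G) (onEdges g₂) e)
      (λ _ → [ inj₁ ∘ sourceIn g₁ , inj₂ ∘ sourceIn g₂ ]′)
      (λ _ → [ inj₁ ∘ targetIn g₁ , inj₂ ∘ targetIn g₂ ]′)
    ι : graph U ↪ G
    ι = inclusion U
    nodeIn : ∀ {v} → v ∈Im onNodes g₁ ⊎ v ∈Im onNodes g₂ → v ∈Im onNodes ι
    nodeIn = Equivalence.from (nodeImage U _)
    edgeIn : ∀ {e} → e ∈Im onEdges g₁ ⊎ e ∈Im onEdges g₂ → e ∈Im onEdges ι
    edgeIn = Equivalence.from (edgeImage U _)
    g₁′ : L r₁ ↪ graph U
    g₁′ = lift g₁ ι (λ v → nodeIn (inj₁ (v , refl))) (λ e → edgeIn (inj₁ (e , refl)))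
    g₂′ : L r₂ ↪ graph U
    g₂′ = lift g₂ ι (λ v → nodeIn (inj₂ (v , refl))) (λ e → edgeIn (inj₂ (e , refl)))
    g₁≗ : ι ∙ g₁′ ≗ g₁
    g₁≗ = (λ v → proj₂ (nodeIn (inj₁ (v , refl)))) , (λ e → proj₂ (edgeIn (inj₁ (e , refl))))
    g₂≗ : ι ∙ g₂′ ≗ g₂
    g₂≗ = (λ v → proj₂ (nodeIn (inj₂ (v , refl)))) , (λ e → proj₂ (edgeIn (inj₂ (e , refl))))
    derived₁ = derive r₁ g₁′ (danglingRestrict {r = r₁} {g₁} {g₁′} ι g₁≗ (Step.dangling d₁))
    derived₂ = derive r₂ g₂′ (danglingRestrict {r = r₂} {g₂} {g₂′} ι g₂≗ (Step.dangling d₂))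
    d₁′ : Step T (graph U) (proj₁ derived₁)
    d₁′ = record { index = Step.index d₁ ; match = g₁′ ; derivation = toDirectDerivation (proj₂ derived₁) }
    d₂′ : Step T (graph U) (proj₁ derived₂)
    d₂′ = record { index = Step.index d₂ ; match = g₂′ ; derivation = toDirectDerivation (proj₂ derived₂) }

    covered : {L₁ L₂ X G : Set} {f₁ : L₁ → G} {f₂ : L₂ → G} {f₁′ : L₁ → X} {f₂′ : L₂ → X} {ι : X → G} →
              Injective _≡_ _≡_ ι → (∀ x → ι (f₁′ x) ≡ f₁ x) → (∀ x → ι (f₂′ x) ≡ f₂ x) →
              ∀ v → ι v ∈Im f₁ ⊎ ι v ∈Im f₂ → v ∈Im f₁′ ⊎ v ∈Im f₂′
    covered ι-injective ≡₁ ≡₂ v (inj₁ (x , eq)) = inj₁ (x , ι-injective (trans (≡₁ x) eq))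
    covered ι-injective ≡₁ ≡₂ v (inj₂ (x , eq)) = inj₂ (x , ι-injective (trans (≡₂ x) eq))

    independentInG : {K₁ L₁ K₂ L₂ X G : Set} {j₁ : K₁ → L₁} {j₂ : K₂ → L₂} {f₁ : L₁ → G} {f₂ : L₂ → G}
      {f₁′ : L₁ → X} {f₂′ : L₂ → X} {ι : X → G} →
      Injective _≡_ _≡_ ι → (∀ x → ι (f₁′ x) ≡ f₁ x) → (∀ x → ι (f₂′ x) ≡ f₂ x) →
      (∀ v → v ∈Im f₁′ → v ∈Im f₂′ → v ∈Im (f₁′ ∘ j₁) × v ∈Im (f₂′ ∘ j₂)) →
      ∀ v → v ∈Im f₁ → v ∈Im f₂ → v ∈Im (f₁ ∘ j₁) × v ∈Im (f₂ ∘ j₂)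
    independentInG {f₁′ = f₁′} {ι = ι} ι-injective ≡₁ ≡₂ ind v (x , x≡) (y , y≡)
      with ind (f₁′ x) (x , refl) (y , ι-injective (trans (≡₂ y) (trans y≡ (trans (sym x≡) (sym (≡₁ x))))))
    ... | (k₁ , k₁≡) , (k₂ , k₂≡) =
      (k₁ , trans (sym (≡₁ _)) (trans (cong ι k₁≡) (trans (≡₁ x) x≡))) ,
      (k₂ , trans (sym (≡₂ _)) (trans (cong ι k₂≡) (trans (≡₁ x) x≡)))

    sameInG : ∀ {i₁ i₂} {f₁ : L (rule T i₁) ↪ G} {f₂ : L (rule T i₂) ↪ G}
              {f₁′ : L (rule T i₁) ↪ graph U} {f₂′ : L (rule T i₂) ↪ graph U} →
              ι ∙ f₁′ ≗ f₁ → ι ∙ f₂′ ≗ f₂ → (eq : i₁ ≡ i₂) →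
              subst (λ i → L (rule T i) ↪ graph U) eq f₁′ ≗ f₂′ → subst (λ i → L (rule T i) ↪ G) eq f₁ ≗ f₂
    sameInG (≡N₁ , ≡E₁) (≡N₂ , ≡E₂) refl (sameN , sameE) =
      (λ v → trans (sym (≡N₁ v)) (trans (cong (onNodes ι) (sameN v)) (≡N₂ v))) ,
      (λ e → trans (sym (≡E₁ e)) (trans (cong (onEdges ι) (sameE e)) (≡E₂ e)))

    -- Independence or equality of the restricted matches would carry over to G along `ι`.
    critical : CriticalPair d₁′ d₂′
    critical = record
      { coverNodes = λ v → covered (onNodes-injective ι) (proj₁ g₁≗) (proj₁ g₂≗) v
          (Equivalence.to (nodeImage U _) (v , refl))
      ; coverEdges = λ e → covered (onEdges-injective ι) (proj₂ g₁≗) (proj₂ g₂≗) e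
          (Equivalence.to (edgeImage U _) (e , refl))
      ; conflict   = λ (indN , indE) → ¬independent
          ( independentInG (onNodes-injective ι) (proj₁ g₁≗) (proj₁ g₂≗) indN
          , independentInG (onEdges-injective ι) (proj₂ g₁≗) (proj₂ g₂≗) indE )
      ; distinct   = λ eq same → ¬same (eq , sameInG {f₁ = g₁} {g₂} {g₁′} {g₂′} g₁≗ g₂≗ eq same)
      }

    -- These are the persistent nodes, described by not being deleted: in this form the condition is
    -- decidable and follows directly from the dangling conditions.
    PreservedByBoth : Pred (Node (graph U)) 0ℓ
    PreservedByBoth x = ¬ (x ∈Im onNodes g₁′ ∖ onNodes (K⊆L r₁)) × ¬ (x ∈Im onNodes g₂′ ∖ onNodes (K⊆L r₂))

    attached : (end : (A : Graph (alphabet T)) → Edge A → Node A) → ∀ e →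
               ¬ (end G e ∈Im onNodes g₁ ∖ onNodes (K⊆L r₁)) → ¬ (end G e ∈Im onNodes g₂ ∖ onNodes (K⊆L r₂)) →
               ∀ x → onNodes ι x ≡ end G e → PreservedByBoth x
    attached end e kept₁ kept₂ x eq =
      kept₁ ∘ ∖-image {j = onNodes (K⊆L r₁)} {ι = onNodes ι} (proj₁ g₁≗) eq ,
      kept₂ ∘ ∖-image {j = onNodes (K⊆L r₂)} {ι = onNodes ι} (proj₁ g₂≗) eq

    preservedByBoth? : Decidable PreservedByBoth
    preservedByBoth? x =
      ¬? (∈Im∖? (nodes (K r₁)) (nodes (L r₁)) (nodes (graph U)) (onNodes g₁′) (onNodes (K⊆L r₁)) x) ×-dec
      ¬? (∈Im∖? (nodes (K r₂)) (nodes (L r₂)) (nodes (graph U)) (onNodes g₂′) (onNodes (K⊆L r₂)) x)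

    -- An edge outside U is matched by neither rule, so the dangling conditions of both original
    -- steps apply to it.
    complementOfU : Complement ι PreservedByBoth
    complementOfU = complement ι preservedByBoth?
      (λ e e∉ → let (s₁ , t₁) = Step.dangling d₁ e (e∉ ∘ edgeIn ∘ inj₁)
                    (s₂ , t₂) = Step.dangling d₂ e (e∉ ∘ edgeIn ∘ inj₂)
                in attached source e s₁ s₂ , attached target e t₁ t₂)
    module C = Complement complementOfU

    joined = joins d₁′ d₂′ ι critical
    ds₁ = proj₁ (proj₂ joined)
    ds₂ = proj₁ (proj₂ (proj₂ joined))

    -- Nodes of the boundary lie in both contexts, hence are persistent; strong joinability supplies
    -- one common image `w` for both tracks.
    tracks : ∀ v → ∃[ w ] (Track (d₁′ ◅ ds₁) (onNodes (inclusion C.boundary) v) w ×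
                           Track (d₂′ ◅ ds₂) (onNodes (inclusion C.boundary) v) w)
    tracks v = proj₂ (proj₂ (proj₂ joined)) _
      ( (let (x , eq) = Equivalence.from (IsRemainder.remainingNodes (Step.deletion d₁′) _) (proj₁ preserved)
         in _ , x , eq , refl)
      , (let (x , eq) = Equivalence.from (IsRemainder.remainingNodes (Step.deletion d₂′) _) (proj₂ preserved)
         in _ , x , eq , refl) )
      where
      preserved : PreservedByBoth (onNodes (inclusion C.boundary) v)
      preserved = Equivalence.to (nodeImage C.boundary _) (v , refl)

    module E₁ = Extensions (extendAlong C.noEdges C.isPushout d₁′ g₁≗
      (fromDirectDerivation (Step.derivation d₁)) ds₁ (proj₁ ∘ proj₂ ∘ tracks))
    module E₂ = Extensions (extendAlong C.noEdges C.isPushout d₂′ g₂≗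
      (fromDirectDerivation (Step.derivation d₂)) ds₂ (proj₂ ∘ proj₂ ∘ tracks))
    module M⁺ = Pushout (pushout C.attachment E₁.boundary)

    -- The common track images enter here: both boundary maps are `w` on nodes, and there are no
    -- edges, so the pushout along the first is also one along the second.
    boundary₂ : IsPushout C.attachment E₂.boundary M⁺.left M⁺.right
    boundary₂ = record
      { nodeGluing = congGluing (nodeGluing M⁺.isPushout) (λ v → trans (E₁.boundary≗ v) (sym (E₂.boundary≗ v)))
      ; edgeGluing = congGluing (edgeGluing M⁺.isPushout) (⊥-elim ∘ C.noEdges)
      }

theorem5p2 : {ℓ : Level} (T : GTSystem) (𝐃 : GraphSet (GTSystem.alphabet T) ℓ) →
    NonGarbageCriticalPairsStronglyJoinable T 𝐃 → LocallyConfluentOn T 𝐃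
theorem5p2 T 𝐃 joins G∈𝐃 d₁ d₂ with sameMatch? d₁ d₂ | parallellyIndependent? d₁ d₂
-- Equality of the matches is decided first, since a pair in conflict is critical only if it is also
-- `distinct`.
... | yes same | _       = join-same d₁ d₂ same
... | no  _    | yes ind = join-independent d₁ d₂ ind
... | no ¬same | no ¬ind = join-conflict d₁ d₂ ¬same ¬ind
  -- The critical part embeds into a member of `𝐃`, so it lies in the subgraph closure.
  (λ d₁′ d₂′ ι critical → joins d₁′ d₂′ critical (subgraph (base G∈𝐃) ι))
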